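{- Let $\lambda$ be an integer partition and let $S(\lambda)$ be the corresponding spider. Then $Y_{S(\lambda)}$ is 2-$s$-positive, or equivalently, the independence polynomial $I_{S(\lambda)}(t)$ is strongly log-concave.
   Context: For a partition $\lambda=(\lambda_1,\ldots,\lambda_\ell)$, the spider $S(\lambda)$ is the tree consisting of a vertex $v_0$ (the torso) together with $\ell$ pairwise disjoint paths (legs) having $\lambda_1,\ldots,\lambda_\ell$ vertices respectively, where one end vertex of each leg is joined by an edge to $v_0$. For a finite simple graph $G$, the independence polynomial is $I_G(t)=\sum_{j=0}^{\alpha(G)} i_jt^j$, where $i_j$ is the number of independent sets of $G$ of cardinality $j$ ($i_0=1$) and $\alpha(G)$ is the maximum size of an independent set. A polynomial $a_0+a_1t+\cdots+a_dt^d$ is strongly log-concave if $a_ma_n\ge a_pa_q$ for all integers $0\le p<m\le n<q\le d$ with $m+n=p+q$. Let $\mathbb{N}=\{0,1,2,\ldots\}$ and let $\mathbf{x}=\{x_1,x_2,\ldots\}$ be indeterminates. For $\alpha:V(G)\to\mathbb{N}$, a multicoloring of $G$ of type $\alpha$ is a map $\kappa$ assigning to each vertex $v$ a finite set $\kappa(v)$ of positive integers with $|\kappa(v)|=\alpha(v)$; it is proper if $\kappa(u)\cap\kappa(v)=\emptyset$ for every edge $uv$. Define $X_G^\alpha=\sum_\kappa x_1^{a_1}x_2^{a_2}\cdots$, summed over all proper multicolorings $\kappa$ of type $\alpha$, where $a_i$ is the number of vertices $v$ with $i\in\kappa(v)$. Define $Y_G=\sum_{\alpha:V(G)\to\mathbb{N}}X_G^\alpha$.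 This is a symmetric formal power series whose homogeneous components are symmetric functions; the coefficient $[s_\lambda]Y_G$ is the coefficient of the Schur function $s_\lambda$ in the component of degree $|\lambda|$. A symmetric function (or such a series) $f$ is 2-$s$-positive if $[s_\lambda]f\ge 0$ for all partitions $\lambda$ with length $\ell(\lambda)\le 2$. -}

module Defs where

open import Data.Empty using (⊥)
open import Data.Fin using (Fin; zero; suc; toℕ; splitAt)
import Data.Fin as Fin
import Data.Fin.Properties as Fin
open import Data.Fin.Permutation using (Permutation; _⟨$⟩ʳ_)
open import Data.Fin.Subset using (Subset; inside; outside; _∈_; _∩_; Empty; ∣_∣)
open import Data.Fin.Subset.Properties using (_∈?_; nonempty?)
open import Data.Integer using (ℤ; +_; 0ℤ)
import Data.Integer as ℤ
open import Data.List using (List; []; _∷_; map; concat; concatMap; filter; length; foldr; upTo; allFin; zip; cartesianProductWith)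
open import Data.Nat.ListAction using (sum)
open import Data.List.Extrema.Nat using (max)
open import Data.List.Relation.Unary.All using (All; all?)
open import Data.List.Relation.Unary.Linked using (Linked; linked?)
open import Data.Nat using (ℕ; zero; suc; _+_; _*_; _≤_; _<_; _≥_)
import Data.Nat as ℕ
open import Data.Product using (_×_; _,_; proj₁; proj₂; map₁)
open import Data.Sum using (_⊎_; inj₁; inj₂; [_,_])
import Data.Sum as Sum
open import Data.Vec using (Vec; []; _∷_; _∷ʳ_; lookup; tabulate; toList)
import Data.Vec as Vec
open import Relation.Binary using (Rel; Decidable; Symmetric; Irreflexive)
open import Relation.Binary.PropositionalEquality using (_≡_; refl; sym)
open import Relation.Nullary using (¬_; no)
open import Relation.Nullary.Decidable using (_×-dec_; _⊎-dec_; _→-dec_; ¬?)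
import Relation.Unary as U
open import Level using (0ℓ)

-- All vectors of length k with entries taken from xs, each listed once when
-- xs has no repetitions.
words : ∀ {A : Set} → List A → (k : ℕ) → List (Vec A k)
words xs zero    = [] ∷ []
words xs (suc k) = cartesianProductWith _∷_ xs (words xs k)

subsets : ∀ n → List (Subset n)
subsets = words (outside ∷ inside ∷ [])

-- Partitions are the lists of their parts; the empty list is the partition of 0.

IsPartition : List ℕ → Set
IsPartition μ = Linked _≥_ μ × All (1 ≤_) μ

isPartition? : U.Decidable IsPartition
isPartition? μ = linked? ℕ._≥?_ μ ×-dec all? (1 ℕ.≤?_) μ

-- A partition of n has at most n parts, each at most n, so the candidates
-- filtered here include every partition of n.
partitions : ℕ → List (List ℕ)
partitions n =
  filter (λ μ → isPartition? μ ×-dec (sum μ ℕ.≟ n))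
    (concatMap (λ k → map toList (words (upTo (suc n)) k)) (upTo (suc n)))

record Graph : Set₁ where
  field
    order  : ℕ
    Adj    : Rel (Fin order) 0ℓ
    adj?   : Decidable Adj
    symm   : Symmetric Adj
    irrefl : Irreflexive _≡_ Adj

  Vertex : Set
  Vertex = Fin order

-- leg i j is the j-th vertex of the i-th leg (both counted from 0), with
-- j = 0 the end that is joined to the torso.
data Position : Set where
  torso : Position
  leg   : (i j : ℕ) → Position

Joined : Position → Position → Set
Joined torso     torso       = ⊥
Joined torso     (leg _ j)   = j ≡ 0
Joined (leg _ j) torso       = j ≡ 0
Joined (leg i j) (leg i′ j′) = i ≡ i′ × (j′ ≡ suc j ⊎ j ≡ suc j′)

joined? : Decidable Joined
joined? torso     torso       = no λ ()
joined? torso     (leg _ j)   = j ℕ.≟ 0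
joined? (leg _ j) torso       = j ℕ.≟ 0
joined? (leg i j) (leg i′ j′) = (i ℕ.≟ i′) ×-dec ((j′ ℕ.≟ suc j) ⊎-dec (j ℕ.≟ suc j′))

joined-sym : Symmetric Joined
joined-sym {torso}   {leg _ _} e       = e
joined-sym {leg _ _} {torso}   e       = e
joined-sym {leg _ _} {leg _ _} (e , s) = sym e , Sum.swap s

joined-irrefl : ∀ p → ¬ Joined p p
joined-irrefl torso     ()
joined-irrefl (leg i j) (_ , inj₁ ())
joined-irrefl (leg i j) (_ , inj₂ ())

-- The leg vertices are numbered leg after leg: (i , j) is the j-th vertex of leg i.
legPosition : (μ : List ℕ) → Fin (sum μ) → ℕ × ℕ
legPosition (k ∷ μ) v = [ (λ j → 0 , toℕ j) , (λ w → map₁ suc (legPosition μ w)) ] (splitAt k v)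

position : (μ : List ℕ) → Fin (suc (sum μ)) → Position
position μ zero    = torso
position μ (suc v) = leg (proj₁ (legPosition μ v)) (proj₂ (legPosition μ v))

spider : List ℕ → Graph
spider μ = record
  { order  = suc (sum μ)
  ; Adj    = λ u v → Joined (position μ u) (position μ v)
  ; adj?   = λ u v → joined? (position μ u) (position μ v)
  ; symm   = λ {u} {v} → joined-sym {position μ u} {position μ v}
  ; irrefl = λ { {u} refl → joined-irrefl (position μ u) }
  }

module _ (G : Graph) where
  open Graph G

  Independent : Subset order → Set
  Independent S = ∀ u v → u ∈ S → v ∈ S → ¬ Adj u v

  independent? : U.Decidable Independent
  independent? S =
    Fin.all? λ u → Fin.all? λ v → (u ∈? S) →-dec ((v ∈? S) →-dec ¬? (adj? u v))

  independentSets : List (Subset order)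
  independentSets = filter independent? (subsets order)

  -- The independence polynomial is Σ_{j ≤ independenceNumber} indepCoeff j · tʲ.
  indepCoeff : ℕ → ℕ
  indepCoeff j = length (filter (λ S → ∣ S ∣ ℕ.≟ j) independentSets)

  independenceNumber : ℕ
  independenceNumber = max 0 (map ∣_∣ independentSets)

-- The property of the polynomial a 0 + a 1 t + ⋯ + a d tᵈ.
StronglyLogConcave : (a : ℕ → ℕ) (d : ℕ) → Set
StronglyLogConcave a d =
  ∀ p m n q → p < m → m ≤ n → n < q → q ≤ d → m + n ≡ p + q → a p * a q ≤ a m * a n

-- A formal power series in x₁, x₂, …, given by its coefficients: the value at
-- e : Vec ℕ n is the coefficient of x₁^e₁ ⋯ xₙ^eₙ.
Series : Set
Series = ∀ {n} → Vec ℕ n → ℤ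

-- A monomial is represented by several vectors, differing in trailing zeros;
-- stable says that its coefficient does not depend on the representative.
record IsSymmetric (f : Series) : Set where
  field
    stable    : ∀ {n} (e : Vec ℕ n) → f (e ∷ʳ 0) ≡ f e
    symmetric : ∀ {n} (π : Permutation n n) (e : Vec ℕ n) →
                f (tabulate λ i → lookup e (π ⟨$⟩ʳ i)) ≡ f e

-- A multicoloring whose colors all lie among 1, …, n is a vector of subsets of
-- Fin n indexed by the vertices. These are all the multicolorings that contribute
-- to the coefficient of a monomial in x₁, …, xₙ.
module _ (G : Graph) where
  open Graph G

  Multicoloring : ℕ → Set
  Multicoloring n = Vec (Subset n) order

  HasType : Vec ℕ order → ∀ {n} → Multicoloring n → Set
  HasType α κ = ∀ v → ∣ lookup κ v ∣ ≡ lookup α v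

  Proper : ∀ {n} → Multicoloring n → Set
  Proper κ = ∀ u v → Adj u v → Empty (lookup κ u ∩ lookup κ v)

  -- The monomial of κ has exponent vector e.
  HasWeight : ∀ {n} → Vec ℕ n → Multicoloring n → Set
  HasWeight e κ = ∀ i → Vec.count (i ∈?_) κ ≡ lookup e i

  hasType? : ∀ α {n} → U.Decidable (HasType α {n})
  hasType? α κ = Fin.all? λ v → ∣ lookup κ v ∣ ℕ.≟ lookup α v

  proper? : ∀ {n} → U.Decidable (Proper {n})
  proper? κ =
    Fin.all? λ u → Fin.all? λ v → adj? u v →-dec ¬? (nonempty? (lookup κ u ∩ lookup κ v))

  hasWeight? : ∀ {n} (e : Vec ℕ n) → U.Decidable (HasWeight e)
  hasWeight? e κ = Fin.all? λ i → Vec.count (i ∈?_) κ ℕ.≟ lookup e i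

  X : Vec ℕ order → ∀ {n} → Vec ℕ n → ℕ
  X α {n} e =
    length (filter (λ κ → hasType? α κ ×-dec (proper? κ ×-dec hasWeight? e κ))
                   (words (subsets n) order))

  -- With n colors no vertex receives more than n of them, so every α that
  -- contributes to a coefficient in x₁, …, xₙ has all its values at most n.
  Y : Series
  Y {n} e = + sum (map (λ α → X α e) (words (upTo (suc n)) order))

-- A filling is the list of its rows, from top to bottom (English notation).
-- Entries in Fin n stand for 1, …, n.

fillings : List ℕ → ∀ n → List (List (List (Fin n)))
fillings []      n = [] ∷ []
fillings (k ∷ μ) n =
  cartesianProductWith (λ r T → toList r ∷ T) (words (allFin n) k) (fillings μ n)

-- zip drops the cells of the upper row that have nothing below them.
Above : ∀ {n} → Rel (List (Fin n)) 0ℓ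
Above r s = All (λ p → proj₁ p Fin.< proj₂ p) (zip r s)

Semistandard : ∀ {n} → List (List (Fin n)) → Set
Semistandard T = All (Linked Fin._≤_) T × Linked Above T

HasContent : ∀ {n} → Vec ℕ n → List (List (Fin n)) → Set
HasContent e T = ∀ i → length (filter (i Fin.≟_) (concat T)) ≡ lookup e i

semistandard? : ∀ {n} → U.Decidable (Semistandard {n})
semistandard? T =
  all? (linked? Fin._≤?_) T
    ×-dec linked? (λ r s → all? (λ p → proj₁ p Fin.<? proj₂ p) (zip r s)) T

hasContent? : ∀ {n} (e : Vec ℕ n) → U.Decidable (HasContent e)
hasContent? e T = Fin.all? λ i → length (filter (i Fin.≟_) (concat T)) ℕ.≟ lookup e i

-- The Schur function s_μ as the generating function of the semistandard Young
-- tableaux of shape μ.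
schur : List ℕ → Series
schur μ {n} e = + length (filter (λ T → semistandard? T ×-dec hasContent? e T) (fillings μ n))

-- f = Σ_μ c μ · s_μ, compared coefficient by coefficient. As s_μ is homogeneous of
-- degree |μ|, only the partitions of the degree of a monomial contribute to its
-- coefficient. Values of c at lists that are not partitions play no role.
IsSchurExpansion : Series → (List ℕ → ℤ) → Set
IsSchurExpansion f c =
  ∀ {n} (e : Vec ℕ n) →
  f e ≡ foldr ℤ._+_ 0ℤ (map (λ μ → c μ ℤ.* schur μ e) (partitions (Vec.sum e)))

-- The Schur functions form a ℤ-basis of the symmetric functions with integer
-- coefficients, so a symmetric f has exactly one expansion c (on partitions), and
-- c μ is the coefficient of s_μ in f.
record TwoSPositive (f : Series) : Set where
  field
    isSymmetric : IsSymmetric f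
    nonNegative : ∀ c → IsSchurExpansion f c →
                  ∀ μ → IsPartition μ → length μ ≤ 2 → 0ℤ ℤ.≤ c μ

{-# OPTIONS --safe #-}
-- The independence polynomial of a spider is F(t) = A(t) + t B(t), where A is the product
-- over the legs of the polynomials g of the paths, and B the product of the polynomials f
-- of the paths without their first vertices. Strong log-concavity of F means that
-- F(x)F(y) is Schur positive. Put p = x + y and q = xy. For each leg,
-- g(x)f(y) = e + x d and g(x)g(y) = e + N with N = p d + q z, where d, e and z are
-- polynomials in p and q with nonnegative coefficients. Hence, S running over the sets of legs,
--   F(x)F(y) = ∏ (e + N) + Σ_S (y x^|S| + x y^|S|) ∏_{S} d ∏_{not S} e + q B(x)B(y).
-- Negative Schur coefficients only come from y x^j + x y^j = q (h_{j-1} − q h_{j-3}), j ≥ 3.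
-- They are compensated by N₁N₂N₃ ⪰ q² d₁d₂d₃ for any three legs, which follows from
-- p² = h₂ + q by induction on the lengths, by N ⪰ p d for the other legs, and by p^j ⪰ h_j.
--
-- For the equivalence, exchanging the roles of colors and vertices turns a proper
-- multicoloring into a sequence of independent sets, so that Y_G has the coefficient
-- ∏ i_{e_j} at x^e. The Kostka numbers at the contents (a, b) and (a+1, b−1) differ only
-- for the shape (a, b), so that [s_(a,b)] Y_G = i_a i_b − i_{a+1} i_{b−1}.
module Submission where

open import Defs
open import Data.List using (List)
open import Data.Nat using (ℕ)
open import Data.Product using (_×_; _,_)

-- The letters g, f, e, d, N, z of the overview are `path`, `pinned`, `cross₀`, `cross₁`, `excess`,
-- `excess₀`. For j = 0, 1, 2 the polynomial y x^j + x y^j is p, 2q, pq. From j = 3 on there is a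
-- debt q² h_{j-3} times a product of d's. The estimate N ⪰ p d alone cannot pay it: apart from the
-- d's it gives p^j, of degree j, while the debt has degree j + 1. Three of the N must therefore
-- supply the factor q² jointly, and this uses how d and z of a leg arise from shorter legs; the
-- other N supply p^{j-3} ⪰ h_{j-3}. All algebra takes place in semirings, where a difference exists
-- only as a remainder r with b = a + r. Positivity is an abstract cone on which the polynomials in
-- p and q act, so that multiplication by p and by q is the only multiplication to be checked. In
-- two variables s_(a,b) = q^b h_{a-b} has constant coefficients on a central stretch of one
-- antidiagonal, so the cone becomes symmetry and unimodality along antidiagonals.

-- Formal power series over a commutative semiring.

module Series where
  open import Algebra.Bundles using (CommutativeSemiring)
  open import Algebra.Structures.Biased using (isCommutativeSemiringˡ)
  open import Data.Nat using (ℕ; zero; suc)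
  open import Data.Product using (_,_)
  open import Level using (0ℓ)
  import Algebra.Solver.Ring.NaturalCoefficients.Default as SemiringSolver
  import Relation.Binary.Reasoning.Setoid as SetoidReasoning

  -- The base is arbitrary so that the construction can be applied to ℕ and then to its own result,
  -- which gives two variables.
  module PowerSeries (R : CommutativeSemiring 0ℓ 0ℓ) where
    open CommutativeSemiring R
    open SemiringSolver R using (solve; _:+_; _:*_; _:=_)
    open SetoidReasoning setoid

    tail : (ℕ → Carrier) → ℕ → Carrier
    tail f n = f (suc n)

    infixl 7 _⊛_
    -- The Cauchy product, from f = f 0 + t · `tail f`. Recursion strips the left factor only.
    _⊛_ : (ℕ → Carrier) → (ℕ → Carrier) → ℕ → Carrier
    (f ⊛ g) zero    = f 0 * g 0
    (f ⊛ g) (suc n) = f 0 * g (suc n) + (tail f ⊛ g) n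

    const : Carrier → ℕ → Carrier
    const a zero    = a
    const a (suc n) = 0#

    shift : (ℕ → Carrier) → ℕ → Carrier
    shift f zero    = 0#
    shift f (suc n) = f n

    private
      variable
        f f′ g g′ h : ℕ → Carrier

    ⊛-cong : (∀ n → f n ≈ f′ n) → (∀ n → g n ≈ g′ n) → ∀ n → (f ⊛ g) n ≈ (f′ ⊛ g′) n
    ⊛-cong p q zero    = *-cong (p 0) (q 0)
    ⊛-cong p q (suc n) = +-cong (*-cong (p 0) (q (suc n))) (⊛-cong (λ k → p (suc k)) q n)

    ⊛-zeroˡ : (∀ n → f n ≈ 0#) → ∀ n → (f ⊛ g) n ≈ 0#
    ⊛-zeroˡ p zero    = trans (*-congʳ (p 0)) (zeroˡ _)
    ⊛-zeroˡ p (suc n) = trans (+-cong (trans (*-congʳ (p 0)) (zeroˡ _)) (⊛-zeroˡ (λ k → p (suc k)) n)) (+-identityˡ 0#)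

    const-⊛ : ∀ a f n → (const a ⊛ f) n ≈ a * f n
    const-⊛ a f zero    = refl
    const-⊛ a f (suc n) = trans (+-congˡ (⊛-zeroˡ (λ _ → refl) n)) (+-identityʳ _)

    const-+ : ∀ a b n → const (a + b) n ≈ const a n + const b n
    const-+ a b zero    = refl
    const-+ a b (suc n) = sym (+-identityˡ _)

    const-* : ∀ a b n → const (a * b) n ≈ (const a ⊛ const b) n
    const-* a b zero    = refl
    const-* a b (suc n) = sym (trans (const-⊛ a (const b) (suc n)) (zeroʳ a))

    shift-⊛ : ∀ f g n → (shift f ⊛ g) n ≈ shift (f ⊛ g) n
    shift-⊛ f g zero    = zeroˡ _
    shift-⊛ f g (suc n) = trans (+-congʳ (zeroˡ _)) (+-identityˡ _)

    shift-cong : (∀ n → f n ≈ g n) → ∀ n → shift f n ≈ shift g n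
    shift-cong p zero    = refl
    shift-cong p (suc n) = p n

    ⊛-distribʳ : ∀ h f g n → ((λ k → f k + g k) ⊛ h) n ≈ (f ⊛ h) n + (g ⊛ h) n
    ⊛-distribʳ h f g zero    = distribʳ _ _ _
    ⊛-distribʳ h f g (suc n) = trans (+-congˡ (⊛-distribʳ h (tail f) (tail g) n))
      (solve 5 (λ a b c u v → (a :+ b) :* c :+ (u :+ v) := (a :* c :+ u) :+ (b :* c :+ v)) refl
             (f 0) (g 0) (h (suc n)) ((tail f ⊛ h) n) ((tail g ⊛ h) n))

    ⊛-scaleˡ : ∀ a f g n → ((λ k → a * f k) ⊛ g) n ≈ a * (f ⊛ g) n
    ⊛-scaleˡ a f g zero    = *-assoc _ _ _
    ⊛-scaleˡ a f g (suc n) = trans (+-congˡ (⊛-scaleˡ a (tail f) g n))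
      (solve 4 (λ a b c u → a :* b :* c :+ a :* u := a :* (b :* c :+ u)) refl a (f 0) (g (suc n)) ((tail f ⊛ g) n))

    -- The mirror image of the defining recursion, stripping the right factor; the two together give
    -- commutativity.
    ⊛-sucʳ : ∀ f g n → (f ⊛ g) (suc n) ≈ (f ⊛ tail g) n + f (suc n) * g 0
    ⊛-sucʳ f g zero    = refl
    ⊛-sucʳ f g (suc n) = trans (+-congˡ (⊛-sucʳ (tail f) g n)) (sym (+-assoc _ _ _))

    ⊛-comm : ∀ f g n → (f ⊛ g) n ≈ (g ⊛ f) n
    ⊛-comm f g zero    = *-comm _ _
    ⊛-comm f g (suc n) = begin
      f 0 * g (suc n) + (tail f ⊛ g) n  ≈⟨ +-cong (*-comm _ _) (⊛-comm (tail f) g n) ⟩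
      g (suc n) * f 0 + (g ⊛ tail f) n  ≈⟨ +-comm _ _ ⟩
      (g ⊛ tail f) n + g (suc n) * f 0  ≈⟨ ⊛-sucʳ g f n ⟨
      (g ⊛ f) (suc n)                   ∎

    ⊛-assoc : ∀ f g h n → ((f ⊛ g) ⊛ h) n ≈ (f ⊛ (g ⊛ h)) n
    ⊛-assoc f g h zero    = *-assoc _ _ _
    ⊛-assoc f g h (suc n) = begin
      f 0 * g 0 * h (suc n) + ((λ k → f 0 * tail g k + (tail f ⊛ g) k) ⊛ h) n
        ≈⟨ +-congˡ (⊛-distribʳ h (λ k → f 0 * tail g k) (tail f ⊛ g) n) ⟩
      f 0 * g 0 * h (suc n) + (((λ k → f 0 * tail g k) ⊛ h) n + ((tail f ⊛ g) ⊛ h) n)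
        ≈⟨ +-congˡ (+-cong (⊛-scaleˡ (f 0) (tail g) h n) (⊛-assoc (tail f) g h n)) ⟩
      f 0 * g 0 * h (suc n) + (f 0 * (tail g ⊛ h) n + (tail f ⊛ (g ⊛ h)) n)
        ≈⟨ solve 5 (λ a b c u v → a :* b :* c :+ (a :* u :+ v) := a :* (b :* c :+ u) :+ v) refl
                 (f 0) (g 0) (h (suc n)) ((tail g ⊛ h) n) ((tail f ⊛ (g ⊛ h)) n) ⟩
      f 0 * (g ⊛ h) (suc n) + (tail f ⊛ (g ⊛ h)) n ∎

    powerSeries : CommutativeSemiring 0ℓ 0ℓ
    powerSeries = record
      { Carrier = ℕ → Carrier
      ; _≈_     = λ f g → ∀ n → f n ≈ g n
      ; _+_     = λ f g n → f n + g n
      ; _*_     = _⊛_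
      ; 0#      = λ _ → 0#
      ; 1#      = const 1#
      ; isCommutativeSemiring = isCommutativeSemiringˡ record
        { +-isCommutativeMonoid = record
          { isMonoid = record
            { isSemigroup = record
              { isMagma = record
                { isEquivalence = ≋-isEquivalence
                ; ∙-cong        = λ p q n → +-cong (p n) (q n)
                }
              ; assoc = λ f g h n → +-assoc _ _ _
              }
            ; identity = (λ f n → +-identityˡ _) , (λ f n → +-identityʳ _)
            }
          ; comm = λ f g n → +-comm _ _
          }
        ; *-isCommutativeMonoid = record
          { isMonoid = record
            { isSemigroup = record
              { isMagma = record
                { isEquivalence = ≋-isEquivalence
                ; ∙-cong        = ⊛-cong
                }
              ; assoc = ⊛-assoc
              }
            ; identity = 1-⊛ , (λ f n → trans (⊛-comm f (const 1#) n) (1-⊛ f n))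
            }
          ; comm = ⊛-comm
          }
        ; distribʳ = ⊛-distribʳ
        ; zeroˡ    = λ f → ⊛-zeroˡ (λ _ → refl)
        }
      }
      where
      open import Relation.Binary.Structures using (IsEquivalence)
      ≋-isEquivalence : IsEquivalence {A = ℕ → Carrier} (λ f g → ∀ n → f n ≈ g n)
      ≋-isEquivalence = record
        { refl  = λ n → refl
        ; sym   = λ p n → sym (p n)
        ; trans = λ p q n → trans (p n) (q n)
        }
      1-⊛ : ∀ f n → (const 1# ⊛ f) n ≈ f n
      1-⊛ f n = trans (const-⊛ 1# f n) (*-identityˡ _)

-- Schur positivity of F(x)F(y) in an abstract cone.

module Cone where
  open import Algebra.Bundles using (CommutativeSemiring)
  open import Data.List using (List; []; _∷_)
  open import Data.Nat using (ℕ; zero; suc)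
  open import Data.Product using (_×_; _,_; ∃)
  open import Level using (0ℓ)
  import Algebra.Solver.Ring.NaturalCoefficients.Default as SemiringSolver
  import Relation.Binary.Reasoning.Setoid as SetoidReasoning

  module SpiderPolynomials (R : CommutativeSemiring 0ℓ 0ℓ) where
    open CommutativeSemiring R

    -- pinned is the polynomial of the path whose first vertex may not be chosen.
    mutual
      path : Carrier → ℕ → Carrier
      path t zero    = 1#
      path t (suc k) = path t k + t * pinned t k

      pinned : Carrier → ℕ → Carrier
      pinned t zero    = 1#
      pinned t (suc k) = path t k

    paths : Carrier → List ℕ → Carrier
    paths t []      = 1#
    paths t (k ∷ μ) = path t k * paths t μ

    pinnedPaths : Carrier → List ℕ → Carrier
    pinnedPaths t []      = 1#
    pinnedPaths t (k ∷ μ) = pinned t k * pinnedPaths t μ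

    spiderPolynomial : Carrier → List ℕ → Carrier
    spiderPolynomial t μ = paths t μ + t * pinnedPaths t μ

  module Symmetric (R : CommutativeSemiring 0ℓ 0ℓ) (x y : CommutativeSemiring.Carrier R) where
    open CommutativeSemiring R
    open SpiderPolynomials R
    open SemiringSolver R using (solve; con; _:+_; _:*_; _:^_; _:=_)
    open SetoidReasoning setoid

    p q : Carrier
    p = x + y
    q = x * y

    infixr 8 _^_
    _^_ : Carrier → ℕ → Carrier
    t ^ zero  = 1#
    t ^ suc n = t * t ^ n

    -- The complete homogeneous polynomial h_n in x and y: a monomial of degree n + 1 is divisible
    -- by x or equal to y^(n+1).
    hom : ℕ → Carrier
    hom zero    = 1#
    hom (suc n) = x * hom n + y ^ suc n

    homʳ : ∀ n → hom (suc n) ≈ y * hom n + x ^ suc n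
    homʳ zero    = +-comm _ _
    homʳ (suc n) = begin
      x * hom (suc n) + y ^ suc (suc n)
        ≈⟨ +-congʳ (*-congˡ (homʳ n)) ⟩
      x * (y * hom n + x ^ suc n) + y * y ^ suc n
        ≈⟨ solve 5 (λ x y h a b → x :* (y :* h :+ a) :+ y :* b := y :* (x :* h :+ b) :+ x :* a) refl
                 x y (hom n) (x ^ suc n) (y ^ suc n) ⟩
      y * hom (suc n) + x ^ suc (suc n) ∎

    -- The Pieri rule for s_1 times a one-row Schur function; in two variables q h_n is the Schur
    -- function of the shape (n+1, 1).
    p*hom : ∀ n → p * hom (suc n) ≈ hom (suc (suc n)) + q * hom n
    p*hom n = begin
      (x + y) * hom (suc n)
        ≈⟨ distribʳ _ _ _ ⟩
      x * hom (suc n) + y * (x * hom n + y ^ suc n)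
        ≈⟨ solve 5 (λ x y h a b → x :* h :+ y :* (x :* a :+ b) := (x :* h :+ y :* b) :+ x :* y :* a) refl
                 x y (hom (suc n)) (hom n) (y ^ suc n) ⟩
      hom (suc (suc n)) + q * hom n ∎

    -- Subtraction-free form of x^(n+2) + y^(n+2) = h_{n+2} - q h_n, the source of every negative
    -- coefficient.
    powerSum : ∀ n → x ^ suc (suc n) + y ^ suc (suc n) + q * hom n ≈ hom (suc (suc n))
    powerSum n = begin
      x * x ^ suc n + y ^ suc (suc n) + q * hom n
        ≈⟨ solve 5 (λ x y a b h → x :* a :+ b :+ x :* y :* h := x :* (y :* h :+ a) :+ b) refl
                 x y (x ^ suc n) (y ^ suc (suc n)) (hom n) ⟩
      x * (y * hom n + x ^ suc n) + y ^ suc (suc n)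
        ≈⟨ +-congʳ (*-congˡ (homʳ n)) ⟨
      hom (suc (suc n)) ∎

    -- The polynomials with natural coefficients in the elementary symmetric polynomials p and q.
    -- They are given by derivations so that their action on a cone is a recursion.
    data Elementary : Carrier → Set where
      resp : ∀ {a b} → a ≈ b → Elementary a → Elementary b
      0∈   : Elementary 0#
      1∈   : Elementary 1#
      p∈   : Elementary p
      q∈   : Elementary q
      _⊕_  : ∀ {a b} → Elementary a → Elementary b → Elementary (a + b)
      _⊗_  : ∀ {a b} → Elementary a → Elementary b → Elementary (a * b)

    infixl 6 _⊕_
    infixl 7 _⊗_

    -- Models the Schur positive polynomials. As s_(a,b) = q^b h_{a-b}, sums, `S-q` and `S-hom`
    -- produce all of them; `S-p` is the Pieri rule.
    record IsSchurCone (S : Carrier → Set) : Set where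
      field
        S-resp : ∀ {a b} → a ≈ b → S a → S b
        S-0    : S 0#
        S-+    : ∀ {a b} → S a → S b → S (a + b)
        S-p    : ∀ {a} → S a → S (p * a)
        S-q    : ∀ {a} → S a → S (q * a)
        S-hom  : ∀ n → S (hom n)

    mutual
      -- Read off from g_{k+1}(x) f_{k+1}(y) = (g_k(x) + x f_k(x)) g_k(y). Here f_k(x) g_k(y) is the
      -- same expression with x and y exchanged, that is e_k + y d_k, and x y d_k = q d_k joins the
      -- part without a factor x.
      cross₀ : ℕ → Carrier
      cross₀ zero    = 1#
      cross₀ (suc k) = diag k + q * cross₁ k

      cross₁ : ℕ → Carrier
      cross₁ zero    = 0#
      cross₁ (suc k) = cross₀ k

      diag : ℕ → Carrier
      diag k = path x k * path y k

    pinnedDiag : ℕ → Carrier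
    pinnedDiag k = pinned x k * pinned y k

    mutual
      cross-xy : ∀ k → path x k * pinned y k ≈ cross₀ k + x * cross₁ k
      cross-xy zero    = solve 1 (λ x → con 1 :* con 1 := con 1 :+ x :* con 0) refl x
      cross-xy (suc k) = begin
        (path x k + x * pinned x k) * path y k
          ≈⟨ solve 4 (λ g f g′ x → (g :+ x :* f) :* g′ := g :* g′ :+ x :* (g′ :* f)) refl
                   (path x k) (pinned x k) (path y k) x ⟩
        diag k + x * (path y k * pinned x k)
          ≈⟨ +-congˡ (*-congˡ (cross-yx k)) ⟩
        diag k + x * (cross₀ k + y * cross₁ k)
          ≈⟨ solve 5 (λ s x y e d → s :+ x :* (e :+ y :* d) := s :+ x :* y :* d :+ x :* e) refl
                   (diag k) x y (cross₀ k) (cross₁ k) ⟩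
        cross₀ (suc k) + x * cross₁ (suc k) ∎

      cross-yx : ∀ k → path y k * pinned x k ≈ cross₀ k + y * cross₁ k
      cross-yx zero    = solve 1 (λ x → con 1 :* con 1 := con 1 :+ x :* con 0) refl y
      cross-yx (suc k) = begin
        (path y k + y * pinned y k) * path x k
          ≈⟨ solve 4 (λ g f g′ y → (g :+ y :* f) :* g′ := g′ :* g :+ y :* (g′ :* f)) refl
                   (path y k) (pinned y k) (path x k) y ⟩
        diag k + y * (path x k * pinned y k)
          ≈⟨ +-congˡ (*-congˡ (cross-xy k)) ⟩
        diag k + y * (cross₀ k + x * cross₁ k)
          ≈⟨ solve 5 (λ s x y e d → s :+ y :* (e :+ x :* d) := s :+ x :* y :* d :+ y :* e) refl
                   (diag k) x y (cross₀ k) (cross₁ k) ⟩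
        cross₀ (suc k) + y * cross₁ (suc k) ∎

    excess₀ : ℕ → Carrier
    excess₀ zero    = 0#
    excess₀ (suc k) = cross₁ k + pinnedDiag k

    excess : ℕ → Carrier
    excess k = p * cross₁ k + q * excess₀ k

    -- Unfolding one vertex, the two mixed products contribute p e + 2 q d. One q d belongs to
    -- `cross₀ (suc k)`, the other to `excess₀ (suc k)`, which explains the formula of the latter; p
    -- e is `p * cross₁ (suc k)`.
    diag-split : ∀ k → diag k ≈ cross₀ k + excess k
    diag-split zero    = solve 2 (λ p q → con 1 :* con 1 := con 1 :+ (p :* con 0 :+ q :* con 0)) refl p q
    diag-split (suc k) = begin
      (path x k + x * pinned x k) * (path y k + y * pinned y k)
        ≈⟨ solve 6 (λ x y g f g′ f′ → (g :+ x :* f) :* (g′ :+ y :* f′) :=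
                     g :* g′ :+ y :* (g :* f′) :+ x :* (g′ :* f) :+ x :* y :* (f :* f′)) refl
                 x y (path x k) (pinned x k) (path y k) (pinned y k) ⟩
      diag k + y * (path x k * pinned y k) + x * (path y k * pinned x k) + q * pinnedDiag k
        ≈⟨ +-congʳ (+-cong (+-congˡ (*-congˡ (cross-xy k))) (*-congˡ (cross-yx k))) ⟩
      diag k + y * (cross₀ k + x * cross₁ k) + x * (cross₀ k + y * cross₁ k) + q * pinnedDiag k
        ≈⟨ solve 6 (λ x y s e d f → s :+ y :* (e :+ x :* d) :+ x :* (e :+ y :* d) :+ x :* y :* f :=
                     (s :+ x :* y :* d) :+ ((x :+ y) :* e :+ x :* y :* (d :+ f))) refl
                 x y (diag k) (cross₀ k) (cross₁ k) (pinnedDiag k) ⟩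
      cross₀ (suc k) + excess (suc k) ∎

    mutual
      cross₀∈ : ∀ k → Elementary (cross₀ k)
      cross₀∈ zero    = 1∈
      cross₀∈ (suc k) = diag∈ k ⊕ q∈ ⊗ cross₁∈ k

      cross₁∈ : ∀ k → Elementary (cross₁ k)
      cross₁∈ zero    = 0∈
      cross₁∈ (suc k) = cross₀∈ k

      pinnedDiag∈ : ∀ k → Elementary (pinnedDiag k)
      pinnedDiag∈ zero    = 1∈ ⊗ 1∈
      pinnedDiag∈ (suc k) = diag∈ k

      excess₀∈ : ∀ k → Elementary (excess₀ k)
      excess₀∈ zero    = 0∈
      excess₀∈ (suc k) = cross₁∈ k ⊕ pinnedDiag∈ k

      -- The two factors are not symmetric on their own; an expression in p and q appears only
      -- through `diag-split`, hence the mutual induction.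
      diag∈ : ∀ k → Elementary (diag k)
      diag∈ zero    = 1∈ ⊗ 1∈
      diag∈ (suc k) = resp (sym (diag-split (suc k)))
        (diag∈ k ⊕ q∈ ⊗ cross₁∈ k ⊕ (p∈ ⊗ cross₀∈ k ⊕ q∈ ⊗ (cross₁∈ k ⊕ pinnedDiag∈ k)))

    excess∈ : ∀ k → Elementary (excess k)
    excess∈ k = p∈ ⊗ cross₁∈ k ⊕ q∈ ⊗ excess₀∈ k

    diags : List ℕ → Carrier
    diags []      = 1#
    diags (k ∷ μ) = diag k * diags μ

    diags∈ : ∀ μ → Elementary (diags μ)
    diags∈ []      = 1∈
    diags∈ (k ∷ μ) = diag∈ k ⊗ diags∈ μ

    -- The sum over the sets S of legs in the overview, the index j counting the legs already put
    -- into S.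
    crossSum : ℕ → List ℕ → Carrier
    crossSum j []      = y * x ^ j + x * y ^ j
    crossSum j (k ∷ μ) = cross₀ k * crossSum j μ + cross₁ k * crossSum (suc j) μ

    -- The two mirror-image products are carried along together: they share the coefficients e and d
    -- of each leg, and choosing d raises the power of x in one and that of y in the other.
    crossSum-correct : ∀ j μ →
      y * x ^ j * (paths x μ * pinnedPaths y μ) + x * y ^ j * (paths y μ * pinnedPaths x μ) ≈ crossSum j μ
    crossSum-correct j []      =
      solve 2 (λ a b → a :* (con 1 :* con 1) :+ b :* (con 1 :* con 1) := a :+ b) refl (y * x ^ j) (x * y ^ j)
    crossSum-correct j (k ∷ μ) = begin
      y * x ^ j * (path x k * A * (pinned y k * B)) + x * y ^ j * (path y k * C * (pinned x k * D))
        ≈⟨ solve 10 (λ a b g A f B g′ C f′ D →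
             a :* (g :* A :* (f :* B)) :+ b :* (g′ :* C :* (f′ :* D)) :=
             g :* f :* (a :* (A :* B)) :+ g′ :* f′ :* (b :* (C :* D))) refl
             (y * x ^ j) (x * y ^ j) (path x k) A (pinned y k) B (path y k) C (pinned x k) D ⟩
      path x k * pinned y k * (y * x ^ j * (A * B)) + path y k * pinned x k * (x * y ^ j * (C * D))
        ≈⟨ +-cong (*-congʳ (cross-xy k)) (*-congʳ (cross-yx k)) ⟩
      (cross₀ k + x * cross₁ k) * (y * x ^ j * (A * B)) + (cross₀ k + y * cross₁ k) * (x * y ^ j * (C * D))
        ≈⟨ solve 8 (λ x y e d a b u v →
             (e :+ x :* d) :* (y :* a :* u) :+ (e :+ y :* d) :* (x :* b :* v) :=
             e :* (y :* a :* u :+ x :* b :* v) :+ d :* (y :* (x :* a) :* u :+ x :* (y :* b) :* v)) refl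
             x y (cross₀ k) (cross₁ k) (x ^ j) (y ^ j) (A * B) (C * D) ⟩
      cross₀ k * (y * x ^ j * (A * B) + x * y ^ j * (C * D)) +
        cross₁ k * (y * x ^ suc j * (A * B) + x * y ^ suc j * (C * D))
        ≈⟨ +-cong (*-congˡ (crossSum-correct j μ)) (*-congˡ (crossSum-correct (suc j) μ)) ⟩
      crossSum j (k ∷ μ) ∎
      where
      A = paths x μ
      B = pinnedPaths y μ
      C = paths y μ
      D = pinnedPaths x μ

    paths-diags : ∀ μ → paths x μ * paths y μ ≈ diags μ
    paths-diags []      = *-identityˡ 1#
    paths-diags (k ∷ μ) = trans
      (solve 4 (λ a b c d → a :* b :* (c :* d) := a :* c :* (b :* d)) refl (path x k) (paths x μ) (path y k) (paths y μ))
      (*-congˡ (paths-diags μ))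

    pinnedPaths∈ : ∀ μ → Elementary (pinnedPaths x μ * pinnedPaths y μ)
    pinnedPaths∈ []      = 1∈ ⊗ 1∈
    pinnedPaths∈ (k ∷ μ) = resp
      (solve 4 (λ a b c d → a :* c :* (b :* d) := a :* b :* (c :* d)) refl
             (pinned x k) (pinnedPaths x μ) (pinned y k) (pinnedPaths y μ))
      (pinnedDiag∈ k ⊗ pinnedPaths∈ μ)

    spider-expansion : ∀ μ → diags μ + crossSum 0 μ + q * (pinnedPaths x μ * pinnedPaths y μ)
                             ≈ spiderPolynomial x μ * spiderPolynomial y μ
    spider-expansion μ = begin
      diags μ + crossSum 0 μ + q * (B * D)
        ≈⟨ +-congʳ (+-cong (paths-diags μ) (crossSum-correct 0 μ)) ⟨
      A * C + (y * 1# * (A * D) + x * 1# * (C * B)) + q * (B * D)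
        ≈⟨ solve 6 (λ x y a b c d → a :* c :+ (y :* con 1 :* (a :* d) :+ x :* con 1 :* (c :* b)) :+ x :* y :* (b :* d)
                      := (a :+ x :* b) :* (c :+ y :* d)) refl x y A B C D ⟩
      (A + x * B) * (C + y * D) ∎
      where
      A = paths x μ
      B = pinnedPaths x μ
      C = paths y μ
      D = pinnedPaths y μ

    -- Compensation of the negative terms.

    module _ {S : Carrier → Set} (isSchurCone : IsSchurCone S) where
      open IsSchurCone isSchurCone

      -- Recursion on the derivation: a sum acts summand by summand and a product by successive
      -- actions, down to multiplication by p and q.
      S-act : ∀ {a c} → Elementary a → S c → S (a * c)
      S-act (resp a≈b u) s = S-resp (*-congʳ a≈b) (S-act u s)
      S-act 0∈           s = S-resp (sym (zeroˡ _)) S-0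
      S-act 1∈           s = S-resp (sym (*-identityˡ _)) s
      S-act p∈           s = S-p s
      S-act q∈           s = S-q s
      S-act (u ⊕ v)      s = S-resp (sym (distribʳ _ _ _)) (S-+ (S-act u s) (S-act v s))
      S-act (u ⊗ v)      s = S-resp (sym (*-assoc _ _ _)) (S-act u (S-act v s))

      S-elementary : ∀ {a} → Elementary a → S a
      S-elementary u = S-resp (*-identityʳ _) (S-act u (S-hom 0))

      infix 4 _⪯_
      -- Stands for b - a ∈ S, which a semiring cannot express directly.
      _⪯_ : Carrier → Carrier → Set
      a ⪯ b = ∃ λ r → S r × b ≈ a + r

      0⪯ : ∀ {a b} → a ≈ 0# → Elementary b → a ⪯ b
      0⪯ {b = b} a≈0 b∈ = b , S-elementary b∈ , sym (trans (+-congʳ a≈0) (+-identityˡ b))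

      -- Each N is p d + q z, where d = ζ + q θ and z = ζ + η share ζ. In N₁N₂N₃ only the term p² q
      -- · `ddz` is rewritten, by p² = h₂ + q, which yields q² · `ddz`. Together with q³ z₁z₂z₃ this
      -- covers q² d₁d₂d₃: in the expansion of d₁d₂d₃ every monomial containing some ζ is found in
      -- `ddz`, and q³ θ₁θ₂θ₃ is what the hypothesis, multiplied by q, provides.
      excess³ : ∀ {ζ₁ ζ₂ ζ₃ θ₁ θ₂ θ₃ η₁ η₂ η₃} →
        Elementary ζ₁ → Elementary ζ₂ → Elementary ζ₃ →
        Elementary θ₁ → Elementary θ₂ → Elementary θ₃ →
        Elementary η₁ → Elementary η₂ → Elementary η₃ →
        q * q * (θ₁ * θ₂ * θ₃) ⪯ ζ₁ * ζ₂ * ζ₃ →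
        let d₁ = ζ₁ + q * θ₁; d₂ = ζ₂ + q * θ₂; d₃ = ζ₃ + q * θ₃ in
        q * q * (d₁ * d₂ * d₃) ⪯
          (p * d₁ + q * (ζ₁ + η₁)) * (p * d₂ + q * (ζ₂ + η₂)) * (p * d₃ + q * (ζ₃ + η₃))
      excess³ {ζ₁} {ζ₂} {ζ₃} {θ₁} {θ₂} {θ₃} {η₁} {η₂} {η₃} ζ₁∈ ζ₂∈ ζ₃∈ θ₁∈ θ₂∈ θ₃∈ η₁∈ η₂∈ η₃∈ (r , r∈ , ζζζ) =
        rest , rest∈ , eq
        where
        d₁ = ζ₁ + q * θ₁
        d₂ = ζ₂ + q * θ₂
        d₃ = ζ₃ + q * θ₃
        z₁ = ζ₁ + η₁
        z₂ = ζ₂ + η₂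
        z₃ = ζ₃ + η₃
        ddz = d₁ * d₂ * z₃ + d₁ * z₂ * d₃ + z₁ * d₂ * d₃
        dzz = d₁ * z₂ * z₃ + z₁ * d₂ * z₃ + z₁ * z₂ * d₃
        -- What is left of `ddz` + q z₁z₂z₃ once d₁d₂d₃ and q r have been taken out; see `absorb`.
        u = d₁ * d₂ * η₃ + d₁ * ζ₂ * ζ₃ + d₁ * η₂ * d₃ + η₁ * d₂ * d₃ + ζ₁ * ζ₂ * d₃ + ζ₁ * (q * θ₂) * ζ₃
            + q * (ζ₁ * ζ₂ * η₃ + ζ₁ * η₂ * z₃ + η₁ * z₂ * z₃)
        v = p * p * p * (d₁ * d₂ * d₃) + p * (q * q) * dzz + q * q * u
        rest = v + (q * ddz * hom 2 + q * (q * (q * r)))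

        d₁∈ = ζ₁∈ ⊕ q∈ ⊗ θ₁∈
        d₂∈ = ζ₂∈ ⊕ q∈ ⊗ θ₂∈
        d₃∈ = ζ₃∈ ⊕ q∈ ⊗ θ₃∈
        z₁∈ = ζ₁∈ ⊕ η₁∈
        z₂∈ = ζ₂∈ ⊕ η₂∈
        z₃∈ = ζ₃∈ ⊕ η₃∈
        ddz∈ = d₁∈ ⊗ d₂∈ ⊗ z₃∈ ⊕ d₁∈ ⊗ z₂∈ ⊗ d₃∈ ⊕ z₁∈ ⊗ d₂∈ ⊗ d₃∈
        dzz∈ = d₁∈ ⊗ z₂∈ ⊗ z₃∈ ⊕ z₁∈ ⊗ d₂∈ ⊗ z₃∈ ⊕ z₁∈ ⊗ z₂∈ ⊗ d₃∈
        u∈ = d₁∈ ⊗ d₂∈ ⊗ η₃∈ ⊕ d₁∈ ⊗ ζ₂∈ ⊗ ζ₃∈ ⊕ d₁∈ ⊗ η₂∈ ⊗ d₃∈ ⊕ η₁∈ ⊗ d₂∈ ⊗ d₃∈ ⊕ ζ₁∈ ⊗ ζ₂∈ ⊗ d₃∈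
             ⊕ ζ₁∈ ⊗ (q∈ ⊗ θ₂∈) ⊗ ζ₃∈
             ⊕ q∈ ⊗ (ζ₁∈ ⊗ ζ₂∈ ⊗ η₃∈ ⊕ ζ₁∈ ⊗ η₂∈ ⊗ z₃∈ ⊕ η₁∈ ⊗ z₂∈ ⊗ z₃∈)
        v∈ = p∈ ⊗ p∈ ⊗ p∈ ⊗ (d₁∈ ⊗ d₂∈ ⊗ d₃∈) ⊕ p∈ ⊗ (q∈ ⊗ q∈) ⊗ dzz∈ ⊕ q∈ ⊗ q∈ ⊗ u∈

        rest∈ : S rest
        rest∈ = S-+ (S-elementary v∈) (S-+ (S-act (q∈ ⊗ ddz∈) (S-hom 2)) (S-q (S-q (S-q r∈))))

        p² : p * p ≈ hom 2 + q
        p² = solve 2 (λ x y → (x :+ y) :* (x :+ y) :=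
                       (x :* (x :* con 1 :+ y :* con 1) :+ y :* (y :* con 1)) :+ x :* y) refl x y

        zzz : z₁ * z₂ * z₃ ≈ q * q * (θ₁ * θ₂ * θ₃) + r + (ζ₁ * ζ₂ * η₃ + ζ₁ * η₂ * z₃ + η₁ * z₂ * z₃)
        zzz = trans
          (solve 6 (λ a b c k l m → (a :+ k) :* (b :+ l) :* (c :+ m) :=
                      a :* b :* c :+ (a :* b :* m :+ a :* l :* (c :+ m) :+ k :* (b :+ l) :* (c :+ m))) refl
                 ζ₁ ζ₂ ζ₃ η₁ η₂ η₃)
          (+-congʳ ζζζ)

        absorb : ddz + q * (z₁ * z₂ * z₃) ≈ d₁ * d₂ * d₃ + u + q * r
        absorb = trans (+-congˡ (*-congˡ zzz))
          (solve 11 (λ q r a b c s t w k l m →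
             let d₁ = a :+ q :* s ; d₂ = b :+ q :* t ; d₃ = c :+ q :* w
                 z₁ = a :+ k ; z₂ = b :+ l ; z₃ = c :+ m
                 tail = a :* b :* m :+ a :* l :* z₃ :+ k :* z₂ :* z₃ in
             d₁ :* d₂ :* z₃ :+ d₁ :* z₂ :* d₃ :+ z₁ :* d₂ :* d₃ :+ q :* (q :* q :* (s :* t :* w) :+ r :+ tail) :=
             d₁ :* d₂ :* d₃ :+ (d₁ :* d₂ :* m :+ d₁ :* b :* c :+ d₁ :* l :* d₃ :+ k :* d₂ :* d₃ :+ a :* b :* d₃
                :+ a :* (q :* t) :* c :+ q :* tail) :+ q :* r)
             refl q r ζ₁ ζ₂ ζ₃ θ₁ θ₂ θ₃ η₁ η₂ η₃)

        eq : (p * d₁ + q * z₁) * (p * d₂ + q * z₂) * (p * d₃ + q * z₃) ≈ q * q * (d₁ * d₂ * d₃) + rest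
        eq = begin
          (p * d₁ + q * z₁) * (p * d₂ + q * z₂) * (p * d₃ + q * z₃)
            ≈⟨ solve 8 (λ p q a b c k l m → (p :* a :+ q :* k) :* (p :* b :+ q :* l) :* (p :* c :+ q :* m) :=
                 p :* p :* p :* (a :* b :* c) :+ p :* (q :* q) :* (a :* l :* m :+ k :* b :* m :+ k :* l :* c)
                 :+ q :* (q :* (q :* (k :* l :* m)))
                 :+ p :* p :* (q :* (a :* b :* m :+ a :* l :* c :+ k :* b :* c))) refl
                 p q d₁ d₂ d₃ z₁ z₂ z₃ ⟩
          p * p * p * (d₁ * d₂ * d₃) + p * (q * q) * dzz + q * (q * (q * (z₁ * z₂ * z₃))) + p * p * (q * ddz)
            ≈⟨ +-congˡ (*-congʳ p²) ⟩
          p * p * p * (d₁ * d₂ * d₃) + p * (q * q) * dzz + q * (q * (q * (z₁ * z₂ * z₃))) + (hom 2 + q) * (q * ddz)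
            ≈⟨ solve 6 (λ m n q z h e → m :+ n :+ q :* (q :* (q :* z)) :+ (h :+ q) :* (q :* e) :=
                 m :+ n :+ q :* q :* (e :+ q :* z) :+ q :* e :* h) refl
                 (p * p * p * (d₁ * d₂ * d₃)) (p * (q * q) * dzz) q (z₁ * z₂ * z₃) (hom 2) ddz ⟩
          p * p * p * (d₁ * d₂ * d₃) + p * (q * q) * dzz + q * q * (ddz + q * (z₁ * z₂ * z₃)) + q * ddz * hom 2
            ≈⟨ +-congʳ (+-congˡ (*-congˡ absorb)) ⟩
          p * p * p * (d₁ * d₂ * d₃) + p * (q * q) * dzz + q * q * (d₁ * d₂ * d₃ + u + q * r) + q * ddz * hom 2
            ≈⟨ solve 7 (λ m n q d u r e → m :+ n :+ q :* q :* (d :+ u :+ q :* r) :+ e :=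
                 q :* q :* d :+ (m :+ n :+ q :* q :* u :+ (e :+ q :* (q :* (q :* r))))) refl
                 (p * p * p * (d₁ * d₂ * d₃)) (p * (q * q) * dzz) q (d₁ * d₂ * d₃) u r (q * ddz * hom 2) ⟩
          q * q * (d₁ * d₂ * d₃) + rest ∎

      private
        -- Two unfoldings give d_{k+2} = `diag k` + q d_k and z_{k+2} = e_k + `diag k`, so `diag k`
        -- is the shared part ζ. At length 1 both d and z are 1, at length 0 both are 0, and ζ
        -- carries everything.
        ζ θ η : ℕ → Carrier
        ζ zero          = 0#
        ζ (suc zero)    = 1#
        ζ (suc (suc k)) = diag k
        θ zero          = 0#
        θ (suc zero)    = 0#
        θ (suc (suc k)) = cross₁ k
        η zero          = 0#
        η (suc zero)    = 0#
        η (suc (suc k)) = cross₀ k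

        ζ∈ : ∀ k → Elementary (ζ k)
        ζ∈ zero          = 0∈
        ζ∈ (suc zero)    = 1∈
        ζ∈ (suc (suc k)) = diag∈ k

        θ∈ : ∀ k → Elementary (θ k)
        θ∈ zero          = 0∈
        θ∈ (suc zero)    = 0∈
        θ∈ (suc (suc k)) = cross₁∈ k

        η∈ : ∀ k → Elementary (η k)
        η∈ zero          = 0∈
        η∈ (suc zero)    = 0∈
        η∈ (suc (suc k)) = cross₀∈ k

        cross₁-split : ∀ k → ζ k + q * θ k ≈ cross₁ k
        cross₁-split zero          = trans (+-identityˡ _) (zeroʳ q)
        cross₁-split (suc zero)    = trans (+-congˡ (zeroʳ q)) (+-identityʳ _)
        cross₁-split (suc (suc k)) = refl

        excess₀-split : ∀ k → ζ k + η k ≈ excess₀ k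
        excess₀-split zero          = +-identityˡ _
        excess₀-split (suc zero)    = trans (+-identityʳ _) (trans (sym (*-identityˡ _)) (sym (+-identityˡ _)))
        excess₀-split (suc (suc k)) = +-comm _ _

        excess-split : ∀ k → p * (ζ k + q * θ k) + q * (ζ k + η k) ≈ excess k
        excess-split k = +-cong (*-congˡ (cross₁-split k)) (*-congˡ (excess₀-split k))

        vanish₁ : ∀ a b → q * q * (0# * a * b) ≈ 0#
        vanish₁ a b = solve 3 (λ q a b → q :* q :* (con 0 :* a :* b) := con 0) refl q a b

        vanish₂ : ∀ a b → q * q * (a * 0# * b) ≈ 0#
        vanish₂ a b = solve 3 (λ q a b → q :* q :* (a :* con 0 :* b) := con 0) refl q a b

        vanish₃ : ∀ a b → q * q * (a * b * 0#) ≈ 0#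
        vanish₃ a b = solve 3 (λ q a b → q :* q :* (a :* b :* con 0) := con 0) refl q a b

      mutual
        -- Induction on the lengths, two vertices at a time. For three legs of length at least two,
        -- `θ³⪯ζ³` compares q² d d d with a product of three `diag` at lengths smaller by two; since
        -- `diag` = e + N contains N, this follows from the present claim there. A shorter leg has θ
        -- = 0.
        cross₁³⪯excess³ : ∀ i j k →
          q * q * (cross₁ i * cross₁ j * cross₁ k) ⪯ excess i * excess j * excess k
        cross₁³⪯excess³ i j k =
          let r , r∈ , eq = excess³ (ζ∈ i) (ζ∈ j) (ζ∈ k) (θ∈ i) (θ∈ j) (θ∈ k) (η∈ i) (η∈ j) (η∈ k) (θ³⪯ζ³ i j k)
          in r , r∈ , (begin
            excess i * excess j * excess k
              ≈⟨ *-cong (*-cong (excess-split i) (excess-split j)) (excess-split k) ⟨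
            _ ≈⟨ eq ⟩
            _ ≈⟨ +-congʳ (*-congˡ (*-cong (*-cong (cross₁-split i) (cross₁-split j)) (cross₁-split k))) ⟩
            q * q * (cross₁ i * cross₁ j * cross₁ k) + r ∎)

        θ³⪯ζ³ : ∀ i j k → q * q * (θ i * θ j * θ k) ⪯ ζ i * ζ j * ζ k
        θ³⪯ζ³ 0 j k = 0⪯ (vanish₁ _ _) (ζ∈ 0 ⊗ ζ∈ j ⊗ ζ∈ k)
        θ³⪯ζ³ 1 j k = 0⪯ (vanish₁ _ _) (ζ∈ 1 ⊗ ζ∈ j ⊗ ζ∈ k)
        θ³⪯ζ³ (suc (suc i)) 0 k = 0⪯ (vanish₂ _ _) (diag∈ i ⊗ ζ∈ 0 ⊗ ζ∈ k)
        θ³⪯ζ³ (suc (suc i)) 1 k = 0⪯ (vanish₂ _ _) (diag∈ i ⊗ ζ∈ 1 ⊗ ζ∈ k)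
        θ³⪯ζ³ (suc (suc i)) (suc (suc j)) 0 = 0⪯ (vanish₃ _ _) (diag∈ i ⊗ diag∈ j ⊗ ζ∈ 0)
        θ³⪯ζ³ (suc (suc i)) (suc (suc j)) 1 = 0⪯ (vanish₃ _ _) (diag∈ i ⊗ diag∈ j ⊗ ζ∈ 1)
        θ³⪯ζ³ (suc (suc i)) (suc (suc j)) (suc (suc k)) =
          let r , r∈ , eq = cross₁³⪯excess³ i j k in
          r + rest , S-+ r∈ (S-elementary rest∈) , (begin
            diag i * diag j * diag k
              ≈⟨ *-cong (*-cong (diag-split i) (diag-split j)) (diag-split k) ⟩
            (e i + N i) * (e j + N j) * (e k + N k)
              ≈⟨ solve 6 (λ a b c u v w → (a :+ u) :* (b :+ v) :* (c :+ w) :=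
                   u :* v :* w :+ (a :* (b :+ v) :* (c :+ w) :+ u :* b :* (c :+ w) :+ u :* v :* c)) refl
                   (e i) (e j) (e k) (N i) (N j) (N k) ⟩
            N i * N j * N k + rest
              ≈⟨ +-congʳ eq ⟩
            q * q * (cross₁ i * cross₁ j * cross₁ k) + r + rest
              ≈⟨ +-assoc _ _ _ ⟩
            q * q * (cross₁ i * cross₁ j * cross₁ k) + (r + rest) ∎)
          where
          e = cross₀
          N = excess
          s∈ : ∀ k → Elementary (e k + N k)
          s∈ k = cross₀∈ k ⊕ excess∈ k
          rest = e i * (e j + N j) * (e k + N k) + N i * e j * (e k + N k) + N i * N j * e k
          rest∈ : Elementary rest
          rest∈ = cross₀∈ i ⊗ s∈ j ⊗ s∈ k ⊕ excess∈ i ⊗ cross₀∈ j ⊗ s∈ k ⊕ excess∈ i ⊗ excess∈ j ⊗ cross₀∈ k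

      p^∈ : ∀ j → Elementary (p ^ j)
      p^∈ zero    = 1∈
      p^∈ (suc j) = p∈ ⊗ p^∈ j

      -- By the Pieri rule, multiplication by p turns h_{j+1} into h_{j+2} plus the positive
      -- remainder q h_j.
      hom⪯p^ : ∀ j → hom j ⪯ p ^ j
      hom⪯p^ 0 = 0# , S-0 , sym (+-identityʳ _)
      hom⪯p^ 1 = 0# , S-0 , solve 2 (λ x y → (x :+ y) :* con 1 := x :* con 1 :+ y :* con 1 :+ con 0) refl x y
      hom⪯p^ (suc (suc j)) =
        let r , r∈ , eq = hom⪯p^ (suc j) in
        q * hom j + p * r , S-+ (S-q (S-hom j)) (S-p r∈) , (begin
          p * p ^ suc j               ≈⟨ *-congˡ eq ⟩
          p * (hom (suc j) + r)       ≈⟨ distribˡ _ _ _ ⟩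
          p * hom (suc j) + p * r     ≈⟨ +-congʳ (p*hom j) ⟩
          hom (suc (suc j)) + q * hom j + p * r   ≈⟨ +-assoc _ _ _ ⟩
          hom (suc (suc j)) + (q * hom j + p * r) ∎)

      -- In S-legs₃ three legs have been split off by cross₁³⪯excess³ and j further legs by
      -- excess k ⪰ p * cross₁ k, and the common factors cross₁ have been cancelled.
      S-legs₃ : ∀ j μ → S (q * q * p ^ j * diags μ + crossSum (suc (suc (suc j))) μ)
      S-legs₃ j [] =
        -- With no leg left, `crossSum` is q (x^(j+2) + y^(j+2)) = q h_{j+2} - q² h_j, and q² p^j
        -- pays for the negative part.
        let r , r∈ , eq = hom⪯p^ j in
        S-resp (sym (begin
          q * q * p ^ j * 1# + (y * (x * x ^ suc (suc j)) + x * (y * y ^ suc (suc j)))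
            ≈⟨ solve 5 (λ x y t a b → x :* y :* (x :* y) :* t :* con 1 :+ (y :* (x :* a) :+ x :* (y :* b)) :=
                          x :* y :* (x :* y :* t :+ (a :+ b))) refl x y (p ^ j) (x ^ suc (suc j)) (y ^ suc (suc j)) ⟩
          q * (q * p ^ j + (x ^ suc (suc j) + y ^ suc (suc j)))
            ≈⟨ *-congˡ (+-congʳ (*-congˡ eq)) ⟩
          q * (q * (hom j + r) + (x ^ suc (suc j) + y ^ suc (suc j)))
            ≈⟨ *-congˡ (solve 4 (λ q h r s → q :* (h :+ r) :+ s := s :+ q :* h :+ q :* r) refl q (hom j) r _) ⟩
          q * (x ^ suc (suc j) + y ^ suc (suc j) + q * hom j + q * r)
            ≈⟨ *-congˡ (+-congʳ (powerSum j)) ⟩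
          q * (hom (suc (suc j)) + q * r) ∎))
          (S-q (S-+ (S-hom (suc (suc j))) (S-q r∈)))
      S-legs₃ j (k ∷ μ) = S-resp (sym (begin
          q * q * p ^ j * (diag k * diags μ) + (cross₀ k * J + cross₁ k * J′)
            ≈⟨ +-congʳ (*-congˡ (*-congʳ (diag-split k))) ⟩
          q * q * p ^ j * ((cross₀ k + (p * cross₁ k + q * excess₀ k)) * diags μ) + (cross₀ k * J + cross₁ k * J′)
            ≈⟨ solve 9 (λ p q t e d z s J J′ →
                 q :* q :* t :* ((e :+ (p :* d :+ q :* z)) :* s) :+ (e :* J :+ d :* J′) :=
                 e :* (q :* q :* t :* s :+ J) :+ d :* (q :* q :* (p :* t) :* s :+ J′) :+ q :* q :* t :* (q :* z) :* s) refl
                 p q (p ^ j) (cross₀ k) (cross₁ k) (excess₀ k) (diags μ) J J′ ⟩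
          cross₀ k * (q * q * p ^ j * diags μ + J) + cross₁ k * (q * q * p ^ suc j * diags μ + J′)
            + q * q * p ^ j * (q * excess₀ k) * diags μ ∎))
        (S-+ (S-+ (S-act (cross₀∈ k) (S-legs₃ j μ)) (S-act (cross₁∈ k) (S-legs₃ (suc j) μ)))
             (S-elementary (q∈ ⊗ q∈ ⊗ p^∈ j ⊗ (q∈ ⊗ excess₀∈ k) ⊗ diags∈ μ)))
        where
        J = crossSum (suc (suc (suc j))) μ
        J′ = crossSum (suc (suc (suc (suc j)))) μ

      -- Decides whether leg k belongs to S. The common factor e is the case outside S; otherwise a
      -- takes up N and b takes up d. In use, a and b are the products of N and of d over the legs
      -- already chosen.
      split-leg : ∀ a b j k μ →
        a * diags (k ∷ μ) + b * crossSum j (k ∷ μ) ≈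
        cross₀ k * (a * diags μ + b * crossSum j μ) + (a * excess k * diags μ + b * cross₁ k * crossSum (suc j) μ)
      split-leg a b j k μ = trans (+-congʳ (*-congˡ (*-congʳ (diag-split k))))
        (solve 8 (λ a b e d N s J J′ → a :* ((e :+ N) :* s) :+ b :* (e :* J :+ d :* J′) :=
                   e :* (a :* s :+ b :* J) :+ (a :* N :* s :+ b :* d :* J′)) refl
                 a b (cross₀ k) (cross₁ k) (excess k) (diags μ) (crossSum j μ) (crossSum (suc j) μ))

      -- With no leg left, `crossSum 2 []` is q p and harmless. Choosing a third leg k creates the
      -- debt: its N completes a triple, which `cross₁³⪯excess³` exchanges for q² D, and the common
      -- factor D leads to `S-legs₃`.
      S-legs₂ : ∀ i j μ → S (excess i * excess j * diags μ + cross₁ i * cross₁ j * crossSum 2 μ)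
      S-legs₂ i j []      = S-elementary (resp
        (solve 4 (λ x y a b → a :* con 1 :+ b :* (x :* y :* (x :+ y)) :=
                    a :* con 1 :+ b :* (y :* (x :* (x :* con 1)) :+ x :* (y :* (y :* con 1)))) refl
               x y (excess i * excess j) (cross₁ i * cross₁ j))
        (excess∈ i ⊗ excess∈ j ⊗ 1∈ ⊕ cross₁∈ i ⊗ cross₁∈ j ⊗ (q∈ ⊗ p∈)))
      S-legs₂ i j (k ∷ μ) = S-resp (sym (split-leg _ _ 2 k μ))
        (S-+ (S-act (cross₀∈ k) (S-legs₂ i j μ))
             (let r , r∈ , eq = cross₁³⪯excess³ i j k in
              S-resp (begin
                D * (q * q * 1# * diags μ + crossSum 3 μ) + diags μ * r
                  ≈⟨ solve 5 (λ q d s J r → d :* (q :* q :* con 1 :* s :+ J) :+ s :* r :=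
                                (q :* q :* d :+ r) :* s :+ d :* J) refl q D (diags μ) (crossSum 3 μ) r ⟩
                (q * q * D + r) * diags μ + D * crossSum 3 μ
                  ≈⟨ +-congʳ (*-congʳ eq) ⟨
                excess i * excess j * excess k * diags μ + D * crossSum 3 μ ∎)
              (S-+ (S-act (cross₁∈ i ⊗ cross₁∈ j ⊗ cross₁∈ k) (S-legs₃ 0 μ)) (S-act (diags∈ μ) r∈))))
        where
        D = cross₁ i * cross₁ j * cross₁ k

      S-legs₁ : ∀ i μ → S (excess i * diags μ + cross₁ i * crossSum 1 μ)
      S-legs₁ i []      = S-elementary (resp
        (solve 4 (λ x y a b → a :* con 1 :+ b :* (x :* y :+ x :* y) :=
                    a :* con 1 :+ b :* (y :* (x :* con 1) :+ x :* (y :* con 1))) refl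
               x y (excess i) (cross₁ i))
        (excess∈ i ⊗ 1∈ ⊕ cross₁∈ i ⊗ (q∈ ⊕ q∈)))
      S-legs₁ i (k ∷ μ) = S-resp (sym (split-leg _ _ 1 k μ))
        (S-+ (S-act (cross₀∈ k) (S-legs₁ i μ)) (S-legs₂ i k μ))

      S-legs₀ : ∀ μ → S (diags μ + crossSum 0 μ)
      S-legs₀ []      = S-elementary (resp
        (solve 2 (λ x y → con 1 :+ (x :+ y) := con 1 :+ (y :* con 1 :+ x :* con 1)) refl x y) (1∈ ⊕ p∈))
      S-legs₀ (k ∷ μ) = S-resp
        (sym (trans (+-cong (*-congʳ (diag-split k)) refl)
          (solve 6 (λ e d N s J J′ → (e :+ N) :* s :+ (e :* J :+ d :* J′) := e :* (s :+ J) :+ (N :* s :+ d :* J′)) refl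
                 (cross₀ k) (cross₁ k) (excess k) (diags μ) (crossSum 0 μ) (crossSum 1 μ))))
        (S-+ (S-act (cross₀∈ k) (S-legs₀ μ)) (S-legs₁ k μ))

      S-spider : ∀ μ → S (spiderPolynomial x μ * spiderPolynomial y μ)
      S-spider μ = S-resp (spider-expansion μ) (S-+ (S-legs₀ μ) (S-q (S-elementary (pinnedPaths∈ μ))))

-- Coefficient arrays in two variables as a Schur cone.

module SpiderPositivity where
  open import Algebra.Bundles using (CommutativeSemiring)
  open import Data.List using (List; []; _∷_)
  open import Data.Nat using (ℕ; zero; suc; _+_; _*_; _≤_; z≤n; s≤s)
  open import Data.Nat.Properties
  open import Data.Sum using (inj₁; inj₂)
  open import Level using (0ℓ)
  open import Relation.Binary.PropositionalEquality using (_≡_; refl; sym; trans; cong; cong₂; subst₂)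
  open Series
  open Cone

  -- F(x) and F(y) are formed in the two-variable semiring; naturality identifies them with the
  -- images of a single coefficient sequence under two embeddings.
  module Naturality (R R′ : CommutativeSemiring 0ℓ 0ℓ) where
    private
      module R  = CommutativeSemiring R
      module R′ = CommutativeSemiring R′
      module P  = SpiderPolynomials R
      module P′ = SpiderPolynomials R′
    open R′ using (_≈_; +-cong; *-cong)

    module _ (φ : R.Carrier → R′.Carrier)
             (φ-1 : φ R.1# ≈ R′.1#)
             (φ-+ : ∀ a b → φ (a R.+ b) ≈ φ a R′.+ φ b)
             (φ-* : ∀ a b → φ (a R.* b) ≈ φ a R′.* φ b)
             {t : R.Carrier} {t′ : R′.Carrier} (φ-t : φ t ≈ t′) where

      mutual
        path-natural : ∀ k → φ (P.path t k) ≈ P′.path t′ k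
        path-natural zero    = φ-1
        path-natural (suc k) = R′.trans (φ-+ _ _)
          (+-cong (path-natural k) (R′.trans (φ-* _ _) (*-cong φ-t (pinned-natural k))))

        pinned-natural : ∀ k → φ (P.pinned t k) ≈ P′.pinned t′ k
        pinned-natural zero    = φ-1
        pinned-natural (suc k) = path-natural k

      paths-natural : ∀ μ → φ (P.paths t μ) ≈ P′.paths t′ μ
      paths-natural []      = φ-1
      paths-natural (k ∷ μ) = R′.trans (φ-* _ _) (*-cong (path-natural k) (paths-natural μ))

      pinnedPaths-natural : ∀ μ → φ (P.pinnedPaths t μ) ≈ P′.pinnedPaths t′ μ
      pinnedPaths-natural []      = φ-1
      pinnedPaths-natural (k ∷ μ) = R′.trans (φ-* _ _) (*-cong (pinned-natural k) (pinnedPaths-natural μ))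

      spiderPolynomial-natural : ∀ μ → φ (P.spiderPolynomial t μ) ≈ P′.spiderPolynomial t′ μ
      spiderPolynomial-natural μ = R′.trans (φ-+ _ _)
        (+-cong (paths-natural μ) (R′.trans (φ-* _ _) (*-cong φ-t (pinnedPaths-natural μ))))

  module P₁ = PowerSeries +-*-commutativeSemiring
  module P₂ = PowerSeries P₁.powerSeries
  module R₁ = CommutativeSemiring P₁.powerSeries
  module R₂ = CommutativeSemiring P₂.powerSeries

  -- c n m is the coefficient of x^m y^n.
  Array : Set
  Array = ℕ → ℕ → ℕ

  t : ℕ → ℕ
  t = P₁.shift R₁.1#

  x y : Array
  x = P₂.const t
  y = P₂.shift R₂.1#

  open Symmetric P₂.powerSeries x y

  t* : ∀ f m → (t R₁.* f) m ≡ P₁.shift f m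
  t* f m = trans (P₁.shift-⊛ R₁.1# f m) (P₁.shift-cong (R₁.*-identityˡ f) m)

  x* : ∀ c n m → (x R₂.* c) n m ≡ P₁.shift (c n) m
  x* c n m = trans (P₂.const-⊛ t c n m) (t* (c n) m)

  y* : ∀ c n m → (y R₂.* c) n m ≡ P₂.shift c n m
  y* c n m = trans (P₂.shift-⊛ R₂.1# c n m) (P₂.shift-cong (R₂.*-identityˡ c) n m)

  p* : ∀ c n m → (p R₂.* c) n m ≡ P₁.shift (c n) m + P₂.shift c n m
  p* c n m = trans (R₂.distribʳ c x y n m) (cong₂ _+_ (x* c n m) (y* c n m))

  q* : ∀ c n m → (q R₂.* c) n m ≡ P₁.shift (P₂.shift c n) m
  q* c n m = trans (R₂.*-assoc x y c n m) (trans (x* (y R₂.* c) n m) (P₁.shift-cong (y* c n) m))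

  -- For a symmetric c this says that all coefficients of its Schur expansion in two
  -- variables are nonnegative.
  record SchurPositive (c : Array) : Set where
    field
      symmetric : ∀ n m → c n m ≡ c m n
      unimodal  : ∀ {n m} → n ≤ m → c n (suc m) ≤ c (suc n) m

  open SchurPositive

  positive-resp : ∀ {c c′} → c R₂.≈ c′ → SchurPositive c → SchurPositive c′
  positive-resp e s .symmetric n m = trans (sym (e n m)) (trans (symmetric s n m) (e m n))
  positive-resp e s .unimodal {n} {m} n≤m = subst₂ _≤_ (e n (suc m)) (e (suc n) m) (unimodal s n≤m)

  positive-+ : ∀ {c c′} → SchurPositive c → SchurPositive c′ → SchurPositive (c R₂.+ c′)
  positive-+ s s′ .symmetric n m = cong₂ _+_ (symmetric s n m) (symmetric s′ n m)
  positive-+ s s′ .unimodal n≤m = +-mono-≤ (unimodal s n≤m) (unimodal s′ n≤m)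

  -- Neighbouring entries of p c on an antidiagonal share one summand; the other two are entries of
  -- c two steps apart.
  positive-p : ∀ {c} → SchurPositive c → SchurPositive (p R₂.* c)
  positive-p {c} s = positive-resp (λ n m → sym (p* c n m)) record { symmetric = symm ; unimodal = unim }
    where
    symm : ∀ n m → P₁.shift (c n) m + P₂.shift c n m ≡ P₁.shift (c m) n + P₂.shift c m n
    symm zero    zero    = refl
    symm zero    (suc m) = trans (+-identityʳ _) (symmetric s 0 m)
    symm (suc n) zero    = trans (symmetric s n 0) (sym (+-identityʳ _))
    symm (suc n) (suc m) = trans (cong₂ _+_ (symmetric s (suc n) m) (symmetric s n (suc m))) (+-comm (c m (suc n)) _)

    two-steps : ∀ {n m} → n ≤ m → c n (suc (suc m)) ≤ c (suc (suc n)) m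
    two-steps {n} {m} n≤m with m≤n⇒m<n∨m≡n n≤m
    ... | inj₁ n<m  = ≤-trans (unimodal s (m≤n⇒m≤1+n n≤m)) (unimodal s n<m)
    -- Here the two entries are mirror images in the diagonal, and `unimodal` would give only the
    -- first of the two steps.
    ... | inj₂ refl = ≤-reflexive (symmetric s n (suc (suc n)))

    unim : ∀ {n m} → n ≤ m →
      c n m + P₂.shift c n (suc m) ≤ P₁.shift (c (suc n)) m + c n m
    unim {zero}  {m}     n≤m = ≤-trans (≤-reflexive (+-identityʳ _)) (m≤n+m (c 0 m) _)
    unim {suc n} {suc m} (s≤s n≤m) = ≤-trans (≤-reflexive (+-comm (c (suc n) (suc m)) _)) (+-monoˡ-≤ _ (two-steps n≤m))

  positive-q : ∀ {c} → SchurPositive c → SchurPositive (q R₂.* c)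
  positive-q {c} s = positive-resp (λ n m → sym (q* c n m)) record { symmetric = symm ; unimodal = unim }
    where
    symm : ∀ n m → P₁.shift (P₂.shift c n) m ≡ P₁.shift (P₂.shift c m) n
    symm zero    zero    = refl
    symm zero    (suc m) = refl
    symm (suc n) zero    = refl
    symm (suc n) (suc m) = symmetric s n m

    unim : ∀ {n m} → n ≤ m → P₂.shift c n m ≤ P₁.shift (c n) m
    unim {zero}          n≤m       = z≤n
    unim {suc n} {suc m} (s≤s n≤m) = unimodal s n≤m

  x^ : ∀ j n m → (x ^ j) (suc n) m ≡ 0
  x^ zero    n m       = refl
  x^ (suc j) n zero    = x* (x ^ j) (suc n) 0
  x^ (suc j) n (suc m) = trans (x* (x ^ j) (suc n) (suc m)) (x^ j n m)

  y^ : ∀ j n m → (y ^ j) n (suc m) ≡ 0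
  y^ zero    zero    m = refl
  y^ zero    (suc n) m = refl
  y^ (suc j) zero    m = y* (y ^ j) 0 (suc m)
  y^ (suc j) (suc n) m = trans (y* (y ^ j) (suc n) (suc m)) (y^ j n m)

  -- Both sides reduce to the entry (n, m) of the polynomial one degree lower: the left by `homʳ`,
  -- since x^(j+1) has no entry in row n + 1, the right by the definition, since y^(j+1) has none in
  -- column m + 1.
  hom-antidiagonal : ∀ j n m → hom j (suc n) m ≡ hom j n (suc m)
  hom-antidiagonal zero    zero    m = refl
  hom-antidiagonal zero    (suc n) m = refl
  hom-antidiagonal (suc j) n       m = trans
    (trans (homʳ j (suc n) m) (trans (cong₂ _+_ (y* (hom j) (suc n) m) (x^ (suc j) n m)) (+-identityʳ _)))
    (sym (trans (cong₂ _+_ (x* (hom j) n (suc m)) (y^ (suc j) n m)) (+-identityʳ _)))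

  hom-symmetric : ∀ j n m → hom j n m ≡ hom j m n
  hom-symmetric j n m = trans (to-axis n m) (sym (trans (to-axis m n) (cong (hom j 0) (+-comm m n))))
    where
    to-axis : ∀ n m → hom j n m ≡ hom j 0 (n + m)
    to-axis zero    m = refl
    to-axis (suc n) m = trans (hom-antidiagonal j n m) (trans (to-axis n (suc m)) (cong (hom j 0) (+-suc n m)))

  schurPositive-isSchurCone : IsSchurCone SchurPositive
  schurPositive-isSchurCone = record
    { S-resp = positive-resp
    ; S-0    = record { symmetric = λ n m → refl ; unimodal = λ _ → z≤n }
    ; S-+    = positive-+
    ; S-p    = positive-p
    ; S-q    = positive-q
    ; S-hom  = λ j → record
      { symmetric = hom-symmetric j
      ; unimodal  = λ {n} {m} _ → ≤-reflexive (sym (hom-antidiagonal j n m))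
      }
    }

  spiderCoeff : List ℕ → ℕ → ℕ
  spiderCoeff = SpiderPolynomials.spiderPolynomial P₁.powerSeries t

  -- The embedding of f(t) as f(y), constant in x; its counterpart for x is `P₂.const`.
  inY : (ℕ → ℕ) → Array
  inY f n = P₁.const (f n)

  inY-* : ∀ f g → inY (f R₁.* g) R₂.≈ inY f R₂.* inY g
  inY-* f g zero    = P₁.const-* (f 0) (g 0)
  inY-* f g (suc n) m = trans (P₁.const-+ (f 0 * g (suc n)) ((P₁.tail f R₁.* g) n) m)
    (cong₂ _+_ (P₁.const-* (f 0) (g (suc n)) m) (inY-* (P₁.tail f) g n m))

  inY-1 : inY R₁.1# R₂.≈ R₂.1#
  inY-1 zero    m       = refl
  inY-1 (suc n) zero    = refl
  inY-1 (suc n) (suc m) = refl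

  inY-t : inY t R₂.≈ y
  inY-t zero    zero    = refl
  inY-t zero    (suc m) = refl
  inY-t (suc n) m       = inY-1 n m

  private
    module P = SpiderPolynomials P₂.powerSeries
    open Naturality P₁.powerSeries P₂.powerSeries

  spider-inX : ∀ μ → P₂.const (spiderCoeff μ) R₂.≈ P.spiderPolynomial x μ
  spider-inX = spiderPolynomial-natural P₂.const (λ n m → refl)
    P₂.const-+ P₂.const-* (λ n m → refl)

  spider-inY : ∀ μ → inY (spiderCoeff μ) R₂.≈ P.spiderPolynomial y μ
  spider-inY = spiderPolynomial-natural inY inY-1
    (λ f g n → P₁.const-+ (f n) (g n)) inY-* inY-t

  coefficient : ∀ f g n m → (P₂.const f R₂.* inY g) n m ≡ f m * g n
  coefficient f g n m = trans (P₂.const-⊛ f (inY g) n m)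
    (trans (R₁.*-comm f (P₁.const (g n)) m) (trans (P₁.const-⊛ (g n) f m) (*-comm (g n) (f m))))

  -- F(x)F(y) has the entry F_m F_n at (n, m), so this is unimodality along its antidiagonals.
  spiderCoeff-step : ∀ μ {n m} → n ≤ m → spiderCoeff μ (suc m) * spiderCoeff μ n ≤ spiderCoeff μ m * spiderCoeff μ (suc n)
  spiderCoeff-step μ {n} {m} n≤m = subst₂ _≤_ (coefficient _ _ n (suc m)) (coefficient _ _ (suc n) m) (unimodal positive n≤m)
    where
    positive : SchurPositive (P₂.const (spiderCoeff μ) R₂.* inY (spiderCoeff μ))
    positive = positive-resp (R₂.sym (R₂.*-cong (spider-inX μ) (spider-inY μ))) (S-spider schurPositive-isSchurCone μ)

-- Finite sums over lists.

module Sums where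
  open import Data.Bool using (Bool; true; false; if_then_else_; _∧_)
  open import Data.List using (List; []; _∷_; map; _++_; filter; length; cartesianProductWith)
  open import Data.List.Properties using (map-cong; map-++; map-∘)
  open import Data.List.Membership.Propositional using (_∈_)
  open import Data.List.Relation.Unary.Any using (here; there)
  open import Data.Nat using (ℕ; suc; _+_; _*_)
  open import Data.Nat.ListAction using (sum)
  open import Data.Nat.ListAction.Properties using (sum-++)
  open import Data.Nat.Properties
  open import Algebra.Properties.CommutativeSemigroup +-commutativeSemigroup using () renaming (interchange to +-interchange)
  open import Function using (_∘_)
  open import Relation.Binary.PropositionalEquality
  open import Relation.Nullary using (does)
  import Relation.Unary as U
  open import Level using (0ℓ)

  private
    variable
      A B C : Set

  ∑ : List A → (A → ℕ) → ℕ
  ∑ xs f = sum (map f xs)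

  𝟙 : Bool → ℕ
  𝟙 b = if b then 1 else 0

  𝟙-∧ : ∀ a b → 𝟙 (a ∧ b) ≡ 𝟙 a * 𝟙 b
  𝟙-∧ false b = refl
  𝟙-∧ true  b = sym (+-identityʳ _)

  ∑-cong : ∀ (xs : List A) {f g} → (∀ a → f a ≡ g a) → ∑ xs f ≡ ∑ xs g
  ∑-cong xs e = cong sum (map-cong e xs)

  ∑-cong-∈ : ∀ (xs : List A) {f g} → (∀ {a} → a ∈ xs → f a ≡ g a) → ∑ xs f ≡ ∑ xs g
  ∑-cong-∈ []       e = refl
  ∑-cong-∈ (x ∷ xs) e = cong₂ _+_ (e (here refl)) (∑-cong-∈ xs (e ∘ there))

  ∑-++ : ∀ (xs ys : List A) f → ∑ (xs ++ ys) f ≡ ∑ xs f + ∑ ys f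
  ∑-++ xs ys f = trans (cong sum (map-++ f xs ys)) (sum-++ (map f xs) (map f ys))

  ∑-map : ∀ (h : A → B) xs f → ∑ (map h xs) f ≡ ∑ xs (f ∘ h)
  ∑-map h xs f = cong sum (sym (map-∘ xs))

  ∑-+ : ∀ (xs : List A) f g → ∑ xs (λ a → f a + g a) ≡ ∑ xs f + ∑ xs g
  ∑-+ []       f g = refl
  ∑-+ (x ∷ xs) f g = begin
    f x + g x + ∑ xs (λ a → f a + g a)  ≡⟨ cong (f x + g x +_) (∑-+ xs f g) ⟩
    f x + g x + (∑ xs f + ∑ xs g)       ≡⟨ +-interchange (f x) (g x) _ _ ⟩
    f x + ∑ xs f + (g x + ∑ xs g)       ∎
    where open ≡-Reasoning

  ∑-0 : ∀ (xs : List A) → ∑ xs (λ _ → 0) ≡ 0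
  ∑-0 []       = refl
  ∑-0 (x ∷ xs) = ∑-0 xs

  ∑-*ˡ : ∀ (xs : List A) c f → ∑ xs (λ a → c * f a) ≡ c * ∑ xs f
  ∑-*ˡ []       c f = sym (*-zeroʳ c)
  ∑-*ˡ (x ∷ xs) c f = trans (cong (c * f x +_) (∑-*ˡ xs c f)) (sym (*-distribˡ-+ c (f x) _))

  ∑-*ʳ : ∀ (xs : List A) f c → ∑ xs (λ a → f a * c) ≡ ∑ xs f * c
  ∑-*ʳ xs f c = trans (∑-cong xs (λ a → *-comm (f a) c)) (trans (∑-*ˡ xs c f) (*-comm c _))

  ∑-swap : ∀ (xs : List A) (ys : List B) (f : A → B → ℕ) → ∑ xs (λ a → ∑ ys (f a)) ≡ ∑ ys (λ b → ∑ xs (λ a → f a b))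
  ∑-swap []       ys f = sym (∑-0 ys)
  ∑-swap (x ∷ xs) ys f = trans (cong (∑ ys (f x) +_) (∑-swap xs ys f)) (sym (∑-+ ys (f x) (λ b → ∑ xs (λ a → f a b))))

  ∑-cartesianProductWith : ∀ (h : A → B → C) xs ys f →
    ∑ (cartesianProductWith h xs ys) f ≡ ∑ xs (λ a → ∑ ys (λ b → f (h a b)))
  ∑-cartesianProductWith h []       ys f = refl
  ∑-cartesianProductWith h (x ∷ xs) ys f = trans (∑-++ (map (h x) ys) _ f)
    (cong₂ _+_ (∑-map (h x) ys f) (∑-cartesianProductWith h xs ys f))

  ∑-filter : ∀ {P : U.Pred A 0ℓ} (P? : U.Decidable P) xs f →
    ∑ (filter P? xs) f ≡ ∑ xs (λ a → 𝟙 (does (P? a)) * f a)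
  ∑-filter P? []       f = refl
  ∑-filter P? (x ∷ xs) f with does (P? x)
  ... | false = ∑-filter P? xs f
  ... | true  = cong₂ _+_ (sym (+-identityʳ _)) (∑-filter P? xs f)

  length-as-∑ : ∀ (xs : List A) → length xs ≡ ∑ xs (λ _ → 1)
  length-as-∑ []       = refl
  length-as-∑ (x ∷ xs) = cong suc (length-as-∑ xs)

  length-filter-as-∑ : ∀ {P : U.Pred A 0ℓ} (P? : U.Decidable P) xs →
    length (filter P? xs) ≡ ∑ xs (λ a → 𝟙 (does (P? a)))
  length-filter-as-∑ P? xs = trans (length-as-∑ (filter P? xs))
    (trans (∑-filter P? xs _) (∑-cong xs (λ a → *-identityʳ _)))

-- Counting the independent sets of a spider.

module SpiderIndependence where
  open Series
  open Cone
  open SpiderPositivity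
  open Sums
  open import Data.Bool using (Bool; true; false; _∧_; not; T; T?)
  open import Data.Bool.Properties using (T-∧)
  open import Data.Fin using (Fin; zero; suc; toℕ; _↑ˡ_; _↑ʳ_; splitAt)
  open import Data.Fin.Properties using (splitAt-↑ˡ; splitAt-↑ʳ; join-splitAt)
  open import Data.Fin.Subset using (Subset; inside; outside; _∈_; ∣_∣)
  open import Data.List using ([]; _∷_)
  open import Data.Nat using (ℕ; zero; suc; _+_; _*_; _≟_)
  open import Data.Nat.ListAction using (sum)
  open import Data.Nat.Properties
  open import Data.Product using (_×_; _,_; proj₁; proj₂)
  open import Data.Sum using (inj₁; inj₂)
  open import Data.Vec using ([]; _∷_; take; drop; here; there)
  open import Function using (_∘_; _⇔_; mk⇔; Equivalence)
  open import Relation.Binary.PropositionalEquality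
  open import Relation.Nullary using (¬_; does; contradiction)
  open import Relation.Nullary.Decidable using (does-⇔)

  -- The generating function, by cardinality, of the subsets accepted by b. Deciding on the first
  -- element matches the recursion of `path`.
  sizeSeries : ∀ n → (Subset n → Bool) → ℕ → ℕ
  sizeSeries zero    b = P₁.const (𝟙 (b []))
  sizeSeries (suc n) b = sizeSeries n (b ∘ (outside ∷_)) R₁.+ P₁.shift (sizeSeries n (b ∘ (inside ∷_)))

  sizeSeries-count : ∀ n b j → ∑ (subsets n) (λ S → 𝟙 (b S) * 𝟙 (does (∣ S ∣ ≟ j))) ≡ sizeSeries n b j
  sizeSeries-count zero    b zero    = trans (+-identityʳ _) (*-identityʳ _)
  sizeSeries-count zero    b (suc j) = trans (+-identityʳ _) (*-zeroʳ (𝟙 (b [])))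
  sizeSeries-count (suc n) b j = trans
    (∑-cartesianProductWith _∷_ (outside ∷ inside ∷ []) (subsets n) (λ S → 𝟙 (b S) * 𝟙 (does (∣ S ∣ ≟ j))))
    (cong₂ _+_ (sizeSeries-count n (b ∘ (outside ∷_)) j) (trans (+-identityʳ _) (with-inside j)))
    where
    with-inside : ∀ j → ∑ (subsets n) (λ S → 𝟙 (b (inside ∷ S)) * 𝟙 (does (suc ∣ S ∣ ≟ j)))
                        ≡ P₁.shift (sizeSeries n (b ∘ (inside ∷_))) j
    with-inside zero    = trans (∑-cong (subsets n) (λ S → *-zeroʳ (𝟙 (b (inside ∷ S))))) (∑-0 (subsets n))
    with-inside (suc j) = sizeSeries-count n (b ∘ (inside ∷_)) j

  sizeSeries-false : ∀ n j → sizeSeries n (λ _ → false) j ≡ 0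
  sizeSeries-false zero    zero    = refl
  sizeSeries-false zero    (suc j) = refl
  sizeSeries-false (suc n) zero    = trans (+-identityʳ _) (sizeSeries-false n 0)
  sizeSeries-false (suc n) (suc j) = cong₂ _+_ (sizeSeries-false n (suc j)) (sizeSeries-false n j)

  -- Turns disjoint legs into factors. Choosing an element of the first block is a shift, and a
  -- shift of the left factor passes through the product.
  sizeSeries-++ : ∀ k m (a : Subset k → Bool) (b : Subset m → Bool) →
    sizeSeries (k + m) (λ S → a (take k S) ∧ b (drop k S)) R₁.≈ sizeSeries k a R₁.* sizeSeries m b
  sizeSeries-++ zero m a b j with a []
  ... | true  = sym (R₁.*-identityˡ (sizeSeries m b) j)
  ... | false = trans (sizeSeries-false m j) (sym (P₁.const-⊛ 0 (sizeSeries m b) j))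
  sizeSeries-++ (suc k) m a b j = trans
    (cong₂ _+_ (sizeSeries-++ k m (a ∘ (outside ∷_)) b j)
               (trans (P₁.shift-cong (sizeSeries-++ k m (a ∘ (inside ∷_)) b) j)
                      (sym (P₁.shift-⊛ _ (sizeSeries m b) j))))
    (sym (R₁.distribʳ (sizeSeries m b) (sizeSeries k (a ∘ (outside ∷_))) _ j))

  -- The flag says whether the vertex preceding the path has been chosen.
  free : ∀ {k} → Bool → Subset k → Bool
  free c []      = true
  free c (b ∷ u) = not (c ∧ b) ∧ free b u

  -- The torso precedes every leg, so one flag serves all of them.
  freeLegs : ∀ μ → Bool → Subset (sum μ) → Bool
  freeLegs []      c S = true
  freeLegs (k ∷ μ) c S = free c (take k S) ∧ freeLegs μ c (drop k S)

  freeSpider : ∀ μ → Subset (suc (sum μ)) → Bool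
  freeSpider μ (c ∷ S) = freeLegs μ c S

  private
    module P = SpiderPolynomials P₁.powerSeries

  mutual
    free-path : ∀ k → sizeSeries k (free false) R₁.≈ P.path t k
    free-path zero      = λ _ → refl
    free-path (suc k) j = cong₂ _+_ (free-path k j)
      (trans (P₁.shift-cong (free-pinned k) j) (sym (t* (P.pinned t k) j)))

    -- With the flag set, choosing the first vertex is rejected at once; leaving it out clears the
    -- flag for the remaining k vertices.
    free-pinned : ∀ k → sizeSeries k (free true) R₁.≈ P.pinned t k
    free-pinned zero      = λ _ → refl
    free-pinned (suc k) j = trans
      (cong₂ _+_ (free-path k j) (trans (P₁.shift-cong (sizeSeries-false k) j) (shift-0 j)))
      (+-identityʳ _)
      where
      shift-0 : ∀ j → P₁.shift (λ _ → 0) j ≡ 0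
      shift-0 zero    = refl
      shift-0 (suc j) = refl

  free-paths : ∀ μ → sizeSeries (sum μ) (freeLegs μ false) R₁.≈ P.paths t μ
  free-paths []      j = refl
  free-paths (k ∷ μ) j = trans (sizeSeries-++ k (sum μ) (free false) (freeLegs μ false) j)
    (R₁.*-cong (free-path k) (free-paths μ) j)

  free-pinnedPaths : ∀ μ → sizeSeries (sum μ) (freeLegs μ true) R₁.≈ P.pinnedPaths t μ
  free-pinnedPaths []      j = refl
  free-pinnedPaths (k ∷ μ) j = trans (sizeSeries-++ k (sum μ) (free true) (freeLegs μ true) j)
    (R₁.*-cong (free-pinned k) (free-pinnedPaths μ) j)

  -- The first bit is the torso: left out, it leaves independent paths; chosen, it costs a factor t
  -- and pins every leg.
  free-spider : ∀ μ → sizeSeries (suc (sum μ)) (freeSpider μ) R₁.≈ spiderCoeff μ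
  free-spider μ j = cong₂ _+_ (free-paths μ j)
    (trans (P₁.shift-cong (free-pinnedPaths μ) j) (sym (t* (P.pinnedPaths t μ) j)))

  -- Independence in leg coordinates. One orientation of each edge is enough, as u and v range over
  -- both orders. The coordinates are a parameter so that a single path and a family of legs are
  -- covered alike.
  NoConsecutive : ∀ {n} → Bool → (Fin n → ℕ × ℕ) → Subset n → Set
  NoConsecutive c pos S =
    (T c → ∀ v → v ∈ S → proj₂ (pos v) ≢ 0) ×
    (∀ u v → u ∈ S → v ∈ S → proj₁ (pos u) ≡ proj₁ (pos v) → proj₂ (pos v) ≢ suc (proj₂ (pos u)))

  pathPosition : ∀ {k} → Fin k → ℕ × ℕ
  pathPosition v = 0 , toℕ v

  free-sound : ∀ {k} c (u : Subset k) → T (free c u) → NoConsecutive c pathPosition u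
  free-sound c []      _ = (λ _ ()) , λ ()
  free-sound c (b ∷ u) f = first c b (proj₁ f′) , rest
    where
    f′ = Equivalence.to T-∧ f
    ih = free-sound b u (proj₂ f′)
    first : ∀ c b → T (not (c ∧ b)) → T c → ∀ v → v ∈ b ∷ u → toℕ v ≢ 0
    first true true () _ zero here
    first _    _    _  _ (suc v) (there _) ()
    rest : ∀ v w → v ∈ b ∷ u → w ∈ b ∷ u → 0 ≡ 0 → toℕ w ≢ suc (toℕ v)
    rest _       zero    _          _          _ ()
    rest zero    (suc w) here       (there w∈) _ e = proj₁ ih _ w w∈ (suc-injective e)
    rest (suc v) (suc w) (there v∈) (there w∈) _ e = proj₂ ih v w v∈ w∈ refl (suc-injective e)

  free-complete : ∀ {k} c (u : Subset k) → NoConsecutive c pathPosition u → T (free c u)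
  free-complete c []      _       = _
  free-complete c (b ∷ u) (h , g) = Equivalence.from T-∧
    (first c b h , free-complete b u ((λ b∈ v v∈ e → second b b∈ v v∈ e g) , λ v w v∈ w∈ _ e → g (suc v) (suc w) (there v∈) (there w∈) refl (cong suc e)))
    where
    first : ∀ c b → (T c → ∀ v → v ∈ b ∷ u → toℕ v ≢ 0) → T (not (c ∧ b))
    first true  true  h = h _ zero here refl
    first true  false h = _
    first false b     h = _
    second : ∀ b → T b → ∀ v → v ∈ u → toℕ v ≡ 0 →
      ¬ (∀ v w → v ∈ b ∷ u → w ∈ b ∷ u → 0 ≡ 0 → toℕ w ≢ suc (toℕ v))
    second true _ v v∈ e g = g zero (suc v) here (there v∈) refl (cong suc e)

  ∈-take : ∀ k {m} (S : Subset (k + m)) i → i ↑ˡ m ∈ S ⇔ i ∈ take k S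
  ∈-take (suc k) (b ∷ S) zero    = mk⇔ (λ { here → here }) (λ { here → here })
  ∈-take (suc k) (b ∷ S) (suc i) = mk⇔
    (λ { (there h) → there (Equivalence.to (∈-take k S i) h) })
    (λ { (there h) → there (Equivalence.from (∈-take k S i) h) })

  ∈-drop : ∀ k {m} (S : Subset (k + m)) j → k ↑ʳ j ∈ S ⇔ j ∈ drop k S
  ∈-drop zero    S       j = mk⇔ (λ h → h) (λ h → h)
  ∈-drop (suc k) (b ∷ S) j = mk⇔
    (λ { (there h) → Equivalence.to (∈-drop k S j) h })
    (λ h → there (Equivalence.from (∈-drop k S j) h))

  position-leg : ∀ k μ i → legPosition (k ∷ μ) (i ↑ˡ sum μ) ≡ (0 , toℕ i)
  position-leg k μ i rewrite splitAt-↑ˡ k i (sum μ) = refl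

  position-later : ∀ k μ j → legPosition (k ∷ μ) (k ↑ʳ j) ≡ (suc (proj₁ (legPosition μ j)) , proj₂ (legPosition μ j))
  position-later k μ j rewrite splitAt-↑ʳ k (sum μ) j = refl

  data Split k m : Fin (k + m) → Set where
    left  : ∀ i → Split k m (i ↑ˡ m)
    right : ∀ j → Split k m (k ↑ʳ j)

  split : ∀ k m v → Split k m v
  split k m v with splitAt k v | join-splitAt k m v
  ... | inj₁ i | refl = left i
  ... | inj₂ j | refl = right j

  freeLegs-sound : ∀ μ c S → T (freeLegs μ c S) → NoConsecutive c (legPosition μ) S
  freeLegs-sound []      c S _ = (λ _ ()) , λ ()
  freeLegs-sound (k ∷ μ) c S f = first , rest
    where
    f′ = Equivalence.to (T-∧ {x = free c (take k S)}) f
    near = free-sound c (take k S) (proj₁ f′)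
    far = freeLegs-sound μ c (drop k S) (proj₂ f′)
    first : T c → ∀ v → v ∈ S → proj₂ (legPosition (k ∷ μ) v) ≢ 0
    first c∈ v v∈ e with split k (sum μ) v
    ... | left i  rewrite position-leg k μ i   = proj₁ near c∈ i (Equivalence.to (∈-take k S i) v∈) e
    ... | right j rewrite position-later k μ j = proj₁ far c∈ j (Equivalence.to (∈-drop k S j) v∈) e
    rest : ∀ u v → u ∈ S → v ∈ S → proj₁ (legPosition (k ∷ μ) u) ≡ proj₁ (legPosition (k ∷ μ) v) →
      proj₂ (legPosition (k ∷ μ) v) ≢ suc (proj₂ (legPosition (k ∷ μ) u))
    rest u v u∈ v∈ s e with split k (sum μ) u | split k (sum μ) v
    ... | left i  | left i′  rewrite position-leg k μ i | position-leg k μ i′ =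
      proj₂ near i i′ (Equivalence.to (∈-take k S i) u∈) (Equivalence.to (∈-take k S i′) v∈) s e
    ... | right j | right j′ rewrite position-later k μ j | position-later k μ j′ =
      proj₂ far j j′ (Equivalence.to (∈-drop k S j) u∈) (Equivalence.to (∈-drop k S j′) v∈) (suc-injective s) e
    ... | left i  | right j  rewrite position-leg k μ i | position-later k μ j = contradiction s λ ()
    ... | right j | left i   rewrite position-leg k μ i | position-later k μ j = contradiction s λ ()

  freeLegs-complete : ∀ μ c S → NoConsecutive c (legPosition μ) S → T (freeLegs μ c S)
  freeLegs-complete []      c S _       = _
  freeLegs-complete (k ∷ μ) c S (h , g) = Equivalence.from T-∧
    ( free-complete c (take k S)
      ( (λ c∈ i i∈ e → h c∈ _ (Equivalence.from (∈-take k S i) i∈) (trans (cong proj₂ (position-leg k μ i)) e))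
      , (λ i i′ i∈ i′∈ s e → g _ _ (Equivalence.from (∈-take k S i) i∈) (Equivalence.from (∈-take k S i′) i′∈)
          (trans (cong proj₁ (position-leg k μ i)) (sym (cong proj₁ (position-leg k μ i′))))
          (trans (cong proj₂ (position-leg k μ i′)) (trans e (cong (suc ∘ proj₂) (sym (position-leg k μ i)))))) )
    , freeLegs-complete μ c (drop k S)
      ( (λ c∈ j j∈ e → h c∈ _ (Equivalence.from (∈-drop k S j) j∈) (trans (cong proj₂ (position-later k μ j)) e))
      , (λ j j′ j∈ j′∈ s e → g _ _ (Equivalence.from (∈-drop k S j) j∈) (Equivalence.from (∈-drop k S j′) j′∈)
          (trans (cong proj₁ (position-later k μ j)) (trans (cong suc s) (sym (cong proj₁ (position-later k μ j′)))))
          (trans (cong proj₂ (position-later k μ j′)) (trans e (cong (suc ∘ proj₂) (sym (position-later k μ j)))))) ) )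

  independent⇔free : ∀ μ S → Independent (spider μ) S ⇔ T (freeSpider μ S)
  independent⇔free μ (c ∷ S) = mk⇔ to from
    where
    to : Independent (spider μ) (c ∷ S) → T (freeLegs μ c S)
    to ind = freeLegs-complete μ c S
      ( (λ c∈ v v∈ e → ind zero (suc v) (torso∈ c c∈) (there v∈) e)
      , (λ u v u∈ v∈ s e → ind (suc u) (suc v) (there u∈) (there v∈) (s , inj₁ e)) )
      where
      torso∈ : ∀ c → T c → zero ∈ c ∷ S
      torso∈ true _ = here
    from : T (freeLegs μ c S) → Independent (spider μ) (c ∷ S)
    from f = indep
      where
      fs = freeLegs-sound μ c S f
      indep : Independent (spider μ) (c ∷ S)
      indep zero    zero    here       here       ()
      indep zero    (suc v) here       (there v∈) e              = proj₁ fs _ v v∈ e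
      indep (suc u) zero    (there u∈) here       e              = proj₁ fs _ u u∈ e
      indep (suc u) (suc v) (there u∈) (there v∈) (s , inj₁ e)   = proj₂ fs u v u∈ v∈ s e
      indep (suc u) (suc v) (there u∈) (there v∈) (s , inj₂ e)   = proj₂ fs v u v∈ u∈ (sym s) e

  indepCoeff-as-∑ : ∀ G j → indepCoeff G j ≡
    ∑ (subsets (Graph.order G)) (λ S → 𝟙 (does (independent? G S)) * 𝟙 (does (∣ S ∣ ≟ j)))
  indepCoeff-as-∑ G j = trans (length-filter-as-∑ (λ S → ∣ S ∣ ≟ j) (independentSets G))
    (∑-filter (independent? G) (subsets _) _)

  indepCoeff-spider : ∀ μ j → indepCoeff (spider μ) j ≡ spiderCoeff μ j
  indepCoeff-spider μ j = begin
    indepCoeff (spider μ) j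
      ≡⟨ indepCoeff-as-∑ (spider μ) j ⟩
    ∑ (subsets (suc (sum μ))) (λ S → 𝟙 (does (independent? (spider μ) S)) * 𝟙 (does (∣ S ∣ ≟ j)))
      ≡⟨ ∑-cong (subsets (suc (sum μ))) (λ S → cong (λ b → 𝟙 b * 𝟙 (does (∣ S ∣ ≟ j)))
           (does-⇔ (independent⇔free μ S) (independent? (spider μ) S) (T? (freeSpider μ S)))) ⟩
    ∑ (subsets (suc (sum μ))) (λ S → 𝟙 (freeSpider μ S) * 𝟙 (does (∣ S ∣ ≟ j)))
      ≡⟨ sizeSeries-count (suc (sum μ)) (freeSpider μ) j ⟩
    sizeSeries (suc (sum μ)) (freeSpider μ) j
      ≡⟨ free-spider μ j ⟩
    spiderCoeff μ j ∎
    where open ≡-Reasoning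

-- Coefficients and symmetry of Y.

module Multicolorings where
  open Sums
  open SpiderIndependence
  open import Data.Bool using (Bool; true; if_then_else_; _∧_)
  import Data.Bool as Bool
  open import Data.Fin using (Fin; zero; suc)
  import Data.Fin.Properties as Fin
  open import Data.Fin.Permutation using (_⟨$⟩ʳ_)
  open import Data.Fin.Subset using (Subset; inside; outside; _∈_; ∣_∣; ⊥)
  open import Data.Fin.Subset.Properties using (_∈?_; x∈p∩q⁺; x∈p∩q⁻; ∣p∣≤n; ∉⊥)
  import Data.Integer as ℤ
  open import Data.List using (List; []; _∷_; upTo; cartesianProductWith)
  import Data.List.Membership.Propositional as List
  open import Data.List.Membership.Propositional.Properties using (∈-upTo⁺)
  open import Data.List.Relation.Unary.All as All using (All; []; _∷_)
  open import Data.List.Relation.Unary.AllPairs using ([]; _∷_)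
  open import Data.List.Relation.Unary.Any using (here; there)
  open import Data.List.Relation.Unary.Unique.Propositional using (Unique)
  open import Data.List.Relation.Unary.Unique.Propositional.Properties using (upTo⁺)
  open import Data.Nat using (ℕ; zero; suc; _+_; _*_; _≟_; s≤s)
  open import Data.Nat.Properties hiding (_≟_)
  open import Data.Product using (_×_; _,_; proj₁; proj₂)
  open import Data.Vec using (Vec; []; _∷_; _∷ʳ_; lookup; tabulate; transpose; zipWith; replicate; _⊛_; count)
  open import Data.Vec.Properties using (lookup-⊛; lookup-replicate; lookup∘tabulate; []=⇒lookup; lookup⇒[]=)
  open import Function using (_∘_; id; _⇔_; mk⇔; Equivalence)
  open import Relation.Binary.PropositionalEquality
  open import Relation.Nullary using (does)
  open import Relation.Nullary.Decidable using (does-⇔; _×-dec_; dec-true; dec-false)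
  import Relation.Unary as U
  open import Level using (0ℓ)
  open import Algebra.Properties.CommutativeMonoid.Sum *-1-commutativeMonoid
    using () renaming (sum to ∏; sum-cong-≗ to ∏-cong; sum-permute to ∏-permute)

  private
    variable
      A : Set

  ∑-single : ∀ {xs : List A} {f a} → Unique xs → a List.∈ xs → (∀ {b} → b List.∈ xs → b ≢ a → f b ≡ 0) → ∑ xs f ≡ f a
  ∑-single {xs = a ∷ xs} {f} (a∉ ∷ _) (here refl) others = trans
    (cong (f a +_) (trans (∑-cong-∈ xs (λ b∈ → others (there b∈) (λ b≡a → All.lookup a∉ b∈ (sym b≡a)))) (∑-0 xs)))
    (+-identityʳ _)
  ∑-single {xs = x ∷ xs} {f} (x∉ ∷ u) (there a∈) others = trans
    (cong (_+ ∑ xs f) (others (here refl) (All.lookup x∉ a∈)))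
    (∑-single u a∈ (others ∘ there))

  𝟙-all? : ∀ {n} {P : U.Pred (Fin n) 0ℓ} (P? : U.Decidable P) → 𝟙 (does (Fin.all? P?)) ≡ ∏ (λ i → 𝟙 (does (P? i)))
  𝟙-all? {zero}  P? = cong 𝟙 (dec-true (Fin.all? P?) λ ())
  𝟙-all? {suc n} P? = trans
    (cong 𝟙 (does-⇔ (mk⇔ (λ h → h zero , h ∘ suc) (λ (h , t) → λ { zero → h ; (suc i) → t i }))
                    (Fin.all? P?) (P? zero ×-dec Fin.all? (P? ∘ suc))))
    (trans (𝟙-∧ (does (P? zero)) _) (cong (𝟙 (does (P? zero)) *_) (𝟙-all? (P? ∘ suc))))

  -- The distributive law: expanding a product of sums chooses one summand in each factor, and the
  -- choices are the words.
  ∑-words-∏ : ∀ (xs : List A) {n} (f : Fin n → A → ℕ) →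
    ∑ (words xs n) (λ w → ∏ (λ i → f i (lookup w i))) ≡ ∏ (λ i → ∑ xs (f i))
  ∑-words-∏ xs {zero}  f = refl
  ∑-words-∏ xs {suc n} f = begin
    ∑ (words xs (suc n)) (λ w → ∏ (λ i → f i (lookup w i)))
      ≡⟨ ∑-cartesianProductWith _∷_ xs (words xs n) _ ⟩
    ∑ xs (λ a → ∑ (words xs n) (λ w → f zero a * ∏ (λ i → f (suc i) (lookup w i))))
      ≡⟨ ∑-cong xs (λ a → ∑-*ˡ (words xs n) (f zero a) _) ⟩
    ∑ xs (λ a → f zero a * ∑ (words xs n) (λ w → ∏ (λ i → f (suc i) (lookup w i))))
      ≡⟨ ∑-*ʳ xs (f zero) _ ⟩
    ∑ xs (f zero) * ∑ (words xs n) (λ w → ∏ (λ i → f (suc i) (lookup w i)))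
      ≡⟨ cong (∑ xs (f zero) *_) (∑-words-∏ xs (f ∘ suc)) ⟩
    ∏ (λ i → ∑ xs (f i)) ∎
    where open ≡-Reasoning

  transpose-zipWith : ∀ {m n} (r : Vec A n) (w : Vec (Vec A m) n) → transpose (zipWith _∷_ r w) ≡ r ∷ transpose w
  transpose-zipWith []      []      = refl
  transpose-zipWith {m = m} (a ∷ r) (v ∷ w) = cong ((replicate (suc m) _∷_ ⊛ (a ∷ v)) ⊛_) (transpose-zipWith r w)

  lookup-transpose : ∀ {m n} (w : Vec (Vec A m) n) v i → lookup (lookup (transpose w) v) i ≡ lookup (lookup w i) v
  lookup-transpose {A = A} {m} {suc n} (a ∷ w) v i = trans (cong (λ u → lookup u i) column) (entry i)
    where
    cons : A → Vec A n → Vec A (suc n)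
    cons = _∷_
    column : lookup (transpose (a ∷ w)) v ≡ lookup a v ∷ lookup (transpose w) v
    column
      rewrite lookup-⊛ v (replicate m cons ⊛ a) (transpose w) | lookup-⊛ v (replicate m cons) a | lookup-replicate v cons
      = refl
    entry : ∀ i → lookup (lookup a v ∷ lookup (transpose w) v) i ≡ lookup (lookup (a ∷ w) i) v
    entry zero    = refl
    entry (suc i) = lookup-transpose w v i

  -- A nonempty column is its top entry and the rest, so a matrix listed by columns is a first row
  -- together with a matrix of smaller height.
  ∑-words-zipWith : ∀ (xs : List A) {m} (ys : List (Vec A m)) n (f : Vec (Vec A (suc m)) n → ℕ) →
    ∑ (words (cartesianProductWith _∷_ xs ys) n) f ≡ ∑ (words xs n) (λ r → ∑ (words ys n) (λ w → f (zipWith _∷_ r w)))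
  ∑-words-zipWith xs ys zero    f = sym (+-identityʳ _)
  ∑-words-zipWith xs ys (suc n) f = begin
    ∑ (words (cartesianProductWith _∷_ xs ys) (suc n)) f
      ≡⟨ ∑-cartesianProductWith _∷_ (cartesianProductWith _∷_ xs ys) _ f ⟩
    ∑ (cartesianProductWith _∷_ xs ys) (λ c → ∑ (words (cartesianProductWith _∷_ xs ys) n) (f ∘ (c ∷_)))
      ≡⟨ ∑-cartesianProductWith _∷_ xs ys _ ⟩
    ∑ xs (λ a → ∑ ys (λ v → ∑ (words (cartesianProductWith _∷_ xs ys) n) (f ∘ ((a ∷ v) ∷_))))
      ≡⟨ ∑-cong xs (λ a → ∑-cong ys (λ v → ∑-words-zipWith xs ys n (f ∘ ((a ∷ v) ∷_)))) ⟩
    ∑ xs (λ a → ∑ ys (λ v → ∑ (words xs n) (λ r → ∑ (words ys n) (λ w → f ((a ∷ v) ∷ zipWith _∷_ r w)))))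
      ≡⟨ ∑-cong xs (λ a → ∑-swap ys (words xs n) _) ⟩
    ∑ xs (λ a → ∑ (words xs n) (λ r → ∑ ys (λ v → ∑ (words ys n) (λ w → f ((a ∷ v) ∷ zipWith _∷_ r w)))))
      ≡⟨ ∑-cong xs (λ a → ∑-cong (words xs n) (λ r → ∑-cartesianProductWith _∷_ ys (words ys n) _)) ⟨
    ∑ xs (λ a → ∑ (words xs n) (λ r → ∑ (words ys (suc n)) (λ w → f (zipWith _∷_ (a ∷ r) w))))
      ≡⟨ ∑-cartesianProductWith _∷_ xs (words xs n) _ ⟨
    ∑ (words xs (suc n)) (λ r → ∑ (words ys (suc n)) (λ w → f (zipWith _∷_ r w))) ∎
    where open ≡-Reasoning

  -- A multicoloring is an incidence matrix; this exchanges the list of color sets of the vertices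
  -- for the list of vertex sets of the colors. Induction removes one row, which on the other side
  -- is the top entry of every column.
  ∑-words-transpose : ∀ (xs : List A) m n (f : Vec (Vec A n) m → ℕ) →
    ∑ (words (words xs n) m) f ≡ ∑ (words (words xs m) n) (f ∘ transpose)
  ∑-words-transpose {A = A} xs zero    n f = trans (+-identityʳ _) (sym (trans (∑-cong (words ([] ∷ []) n) (λ w → cong f (no-rows (transpose w)))) (constant n (f []))))
    where
    no-rows : ∀ {B : Set} (v : Vec B 0) → v ≡ []
    no-rows [] = refl
    empties : ∀ n → List (Vec (Vec A 0) n)
    empties = words ([] ∷ [])
    cons : ∀ {n} → Vec A 0 → Vec (Vec A 0) n → Vec (Vec A 0) (suc n)
    cons = _∷_
    constant : ∀ n c → ∑ (empties n) (λ _ → c) ≡ c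
    constant zero    c = +-identityʳ c
    constant (suc n) c = trans (∑-cartesianProductWith cons ([] ∷ []) (empties n) (λ _ → c)) (trans (+-identityʳ _) (constant n c))
  ∑-words-transpose xs (suc m) n f = begin
    ∑ (words (words xs n) (suc m)) f
      ≡⟨ ∑-cartesianProductWith _∷_ (words xs n) _ f ⟩
    ∑ (words xs n) (λ r → ∑ (words (words xs n) m) (λ κ → f (r ∷ κ)))
      ≡⟨ ∑-cong (words xs n) (λ r → ∑-words-transpose xs m n (f ∘ (r ∷_))) ⟩
    ∑ (words xs n) (λ r → ∑ (words (words xs m) n) (λ w → f (r ∷ transpose w)))
      ≡⟨ ∑-cong (words xs n) (λ r → ∑-cong (words (words xs m) n) (λ w → cong f (transpose-zipWith r w))) ⟨
    ∑ (words xs n) (λ r → ∑ (words (words xs m) n) (λ w → f (transpose (zipWith _∷_ r w))))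
      ≡⟨ ∑-words-zipWith xs (words xs m) n (f ∘ transpose) ⟨
    ∑ (words (words xs (suc m)) n) (f ∘ transpose) ∎
    where open ≡-Reasoning

  count-∈ : ∀ {m n} (i : Fin n) (κ : Vec (Subset n) m) (S : Subset m) →
    (∀ v → i ∈ lookup κ v ⇔ v ∈ S) → count (i ∈?_) κ ≡ ∣ S ∣
  count-∈ i []      []      h = refl
  count-∈ i (R ∷ κ) (b ∷ S) h = cong₂ (λ d → if d then suc else id)
    (does-⇔ (mk⇔ (here⁻ ∘ Equivalence.to (h zero)) (Equivalence.from (h zero) ∘ here⁺)) (i ∈? R) (b Bool.≟ inside))
    (count-∈ i κ S (λ v → mk⇔ (there⁻ ∘ Equivalence.to (h (suc v))) (Equivalence.from (h (suc v)) ∘ Data.Vec.there)))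
    where
    here⁻ : zero ∈ b ∷ S → b ≡ inside
    here⁻ Data.Vec.here = refl
    here⁺ : b ≡ inside → zero ∈ b ∷ S
    here⁺ refl = Data.Vec.here
    there⁻ : ∀ {v} → suc v ∈ b ∷ S → v ∈ S
    there⁻ (Data.Vec.there v∈) = v∈

  module _ (G : Graph) where
    open Graph G

    ∈-transpose : ∀ {n} (w : Vec (Subset order) n) i v → i ∈ lookup (transpose w) v ⇔ v ∈ lookup w i
    ∈-transpose w i v = mk⇔
      (λ h → lookup⇒[]= v (lookup w i) (trans (sym (lookup-transpose w v i)) ([]=⇒lookup h)))
      (λ h → lookup⇒[]= i (lookup (transpose w) v) (trans (lookup-transpose w v i) ([]=⇒lookup h)))

    ColorClass : ℕ → Subset order → Set
    ColorClass k S = Independent G S × ∣ S ∣ ≡ k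

    colorClass? : ∀ k → U.Decidable (ColorClass k)
    colorClass? k S = independent? G S ×-dec (∣ S ∣ ≟ k)

    -- The entries of w are the color classes: an improper edge is an edge inside one class, and the
    -- exponent of a color is the size of its class.
    proper⇔independent : ∀ {n} (e : Vec ℕ n) (w : Vec (Subset order) n) →
      (Proper G (transpose w) × HasWeight G e (transpose w)) ⇔ (∀ i → ColorClass (lookup e i) (lookup w i))
    proper⇔independent e w = mk⇔
      (λ (proper , weight) i →
        (λ u v u∈ v∈ uv → proper u v uv (i , x∈p∩q⁺ (Equivalence.from (∈-transpose w i u) u∈ , Equivalence.from (∈-transpose w i v) v∈)))
        , trans (sym (size i)) (weight i))
      (λ h →
        (λ u v uv (i , i∈) → let u∈ , v∈ = x∈p∩q⁻ _ _ i∈ in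
          proj₁ (h i) u v (Equivalence.to (∈-transpose w i u) u∈) (Equivalence.to (∈-transpose w i v) v∈) uv)
        , λ i → trans (size i) (proj₂ (h i)))
      where
      size : ∀ i → count (i ∈?_) (transpose w) ≡ ∣ lookup w i ∣
      size i = count-∈ i (transpose w) (lookup w i) (∈-transpose w i)

    colorClasses : ∀ k → ∑ (subsets order) (λ S → 𝟙 (does (colorClass? k S))) ≡ indepCoeff G k
    colorClasses k = trans
      (∑-cong (subsets order) (λ S → 𝟙-∧ (does (independent? G S)) _))
      (sym (indepCoeff-as-∑ G k))

    -- A multicoloring has exactly one type, whose values are at most n, so summing over α merely
    -- removes the condition on the type.
    types : ∀ {n} (κ : Multicoloring G n) → ∑ (words (upTo (suc n)) order) (λ α → 𝟙 (does (hasType? G α κ))) ≡ 1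
    types {n} κ = begin
      ∑ (words (upTo (suc n)) order) (λ α → 𝟙 (does (hasType? G α κ)))
        ≡⟨ ∑-cong (words (upTo (suc n)) order) (λ α → 𝟙-all? (λ v → ∣ lookup κ v ∣ ≟ lookup α v)) ⟩
      ∑ (words (upTo (suc n)) order) (λ α → ∏ (λ v → 𝟙 (does (∣ lookup κ v ∣ ≟ lookup α v))))
        ≡⟨ ∑-words-∏ (upTo (suc n)) (λ v a → 𝟙 (does (∣ lookup κ v ∣ ≟ a))) ⟩
      ∏ (λ v → ∑ (upTo (suc n)) (λ a → 𝟙 (does (∣ lookup κ v ∣ ≟ a))))
        ≡⟨ ∏-cong (λ v → trans
             (∑-single (upTo⁺ (suc n)) (∈-upTo⁺ (s≤s (∣p∣≤n (lookup κ v))))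
               (λ {b} _ b≢ → cong 𝟙 (dec-false (∣ lookup κ v ∣ ≟ b) (b≢ ∘ sym))))
             (cong 𝟙 (dec-true (∣ lookup κ v ∣ ≟ _) refl))) ⟩
      ∏ {order} (λ v → 1)
        ≡⟨ ∏-1 order ⟩
      1 ∎
      where
      open ≡-Reasoning
      ∏-1 : ∀ n → ∏ {n} (λ v → 1) ≡ 1
      ∏-1 zero    = refl
      ∏-1 (suc n) = trans (+-identityʳ _) (∏-1 n)

    Y-product : ∀ {n} (e : Vec ℕ n) → Y G e ≡ ℤ.+ ∏ (λ i → indepCoeff G (lookup e i))
    Y-product {n} e = cong ℤ.+_ (begin
      ∑ αs (λ α → X G α e)
        ≡⟨ ∑-cong αs (λ α → length-filter-as-∑ (λ κ → hasType? G α κ ×-dec (proper? G κ ×-dec hasWeight? G e κ)) κs) ⟩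
      ∑ αs (λ α → ∑ κs (λ κ → 𝟙 (does (hasType? G α κ) ∧ good κ)))
        ≡⟨ ∑-swap αs κs _ ⟩
      ∑ κs (λ κ → ∑ αs (λ α → 𝟙 (does (hasType? G α κ) ∧ good κ)))
        ≡⟨ ∑-cong κs (λ κ → trans (∑-cong αs (λ α → 𝟙-∧ (does (hasType? G α κ)) (good κ)))
             (trans (∑-*ʳ αs (λ α → 𝟙 (does (hasType? G α κ))) (𝟙 (good κ))) (trans (cong (_* 𝟙 (good κ)) (types κ)) (+-identityʳ _)))) ⟩
      ∑ κs (λ κ → 𝟙 (good κ))
        ≡⟨ ∑-words-transpose (outside ∷ inside ∷ []) order n (𝟙 ∘ good) ⟩
      ∑ (words (subsets order) n) (λ w → 𝟙 (good (transpose w)))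
        ≡⟨ ∑-cong (words (subsets order) n) (λ w → trans
             (cong 𝟙 (does-⇔ (proper⇔independent e w) (proper? G (transpose w) ×-dec hasWeight? G e (transpose w))
                              (Fin.all? (λ i → colorClass? (lookup e i) (lookup w i)))))
             (𝟙-all? (λ i → colorClass? (lookup e i) (lookup w i)))) ⟩
      ∑ (words (subsets order) n) (λ w → ∏ (λ i → 𝟙 (does (colorClass? (lookup e i) (lookup w i)))))
        ≡⟨ ∑-words-∏ (subsets order) (λ i S → 𝟙 (does (colorClass? (lookup e i) S))) ⟩
      ∏ (λ i → ∑ (subsets order) (λ S → 𝟙 (does (colorClass? (lookup e i) S))))
        ≡⟨ ∏-cong (λ i → colorClasses (lookup e i)) ⟩
      ∏ (λ i → indepCoeff G (lookup e i)) ∎)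
      where
      open ≡-Reasoning
      αs = words (upTo (suc n)) order
      κs = words (subsets n) order
      good : Multicoloring G n → Bool
      good κ = does (proper? G κ) ∧ does (hasWeight? G e κ)

    -- An appended exponent 0 multiplies the coefficient of Y by this number, so stability rests on
    -- it.
    indepCoeff-0 : indepCoeff G 0 ≡ 1
    indepCoeff-0 = trans (indepCoeff-as-∑ G 0)
      (trans (sizeSeries-count order (does ∘ independent? G) 0)
             (sizeSeries-0 order _ (dec-true (independent? G ⊥) (λ u v u∈ _ _ → ∉⊥ u∈))))
      where
      sizeSeries-0 : ∀ n b → b ⊥ ≡ true → sizeSeries n b 0 ≡ 1
      sizeSeries-0 zero    b h = cong 𝟙 h
      sizeSeries-0 (suc n) b h = trans (+-identityʳ _) (sizeSeries-0 n _ h)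

    Y-isSymmetric : IsSymmetric (Y G)
    Y-isSymmetric = record
      { stable    = λ e → trans (Y-product (e ∷ʳ 0)) (trans (cong ℤ.+_ (append-0 e)) (sym (Y-product e)))
      ; symmetric = λ π e → trans (Y-product (tabulate (λ i → lookup e (π ⟨$⟩ʳ i)))) (trans
          (cong ℤ.+_ (trans (∏-cong (λ i → cong (indepCoeff G) (lookup∘tabulate (λ i → lookup e (π ⟨$⟩ʳ i)) i)))
                          (sym (∏-permute (λ i → indepCoeff G (lookup e i)) π))))
          (sym (Y-product e)))
      }
      where
      append-0 : ∀ {n} (e : Vec ℕ n) → ∏ (λ i → indepCoeff G (lookup (e ∷ʳ 0) i)) ≡ ∏ (λ i → indepCoeff G (lookup e i))
      append-0 []      = cong (_* 1) indepCoeff-0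
      append-0 (k ∷ e) = cong (indepCoeff G k *_) (append-0 e)

-- Kostka numbers for contents in two letters.

module TwoVariableTableaux where
  open Sums
  open Multicolorings
  open import Data.Fin using (Fin)
  open import Data.Fin.Patterns using (0F; 1F)
  import Data.Fin as Fin
  import Data.Fin.Properties as Fin
  open import Data.List using (List; []; _∷_; _++_; filter; length; map; upTo; allFin; concat; concatMap; replicate)
  open import Data.List.Membership.Propositional using (_∈_)
  open import Data.List.Membership.Propositional.Properties
  open import Data.List.Properties using (∷-injectiveˡ; ∷-injectiveʳ; length-++; length-replicate; filter-++; filter-none; ++-identityʳ)
  open import Data.List.Relation.Unary.All as All using (All; []; _∷_)
  import Data.List.Relation.Unary.All.Properties as All
  open import Data.List.Relation.Unary.AllPairs as AllPairs using ([]; _∷_)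
  import Data.List.Relation.Unary.AllPairs.Properties as AllPairs
  open import Data.List.Relation.Unary.Any as Any using (here)
  open import Data.List.Relation.Unary.Linked as Linked using (Linked; []; [-]; _∷_)
  open import Data.List.Relation.Unary.Unique.Propositional using (Unique)
  import Data.List.Relation.Unary.Unique.Propositional.Properties as Unique
  open import Data.Nat using (ℕ; zero; suc; _+_; _≤_; _<_; _≟_; z≤n; s≤s)
  open import Data.Nat.ListAction using (sum)
  open import Data.Nat.Properties hiding (_≟_)
  open import Data.Product using (_×_; _,_; proj₂; ∃₂)
  open import Data.Vec using (Vec; []; _∷_; toList; fromList)
  import Data.Vec.Properties as Vec
  open import Function using (_∘_)
  open import Relation.Binary.PropositionalEquality
  open import Relation.Nullary using (¬_; does)
  open import Relation.Nullary.Decidable using (_×-dec_; dec-true; dec-false)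
  import Relation.Unary as U

  private
    variable
      A : Set

  words-unique : ∀ {xs : List A} → Unique xs → ∀ k → Unique (words xs k)
  words-unique u zero    = [] ∷ []
  words-unique u (suc k) = Unique.cartesianProductWith⁺ _∷_ Vec.∷-injective u (words-unique u k)

  toList-injective : ∀ {n} {v w : Vec A n} → toList v ≡ toList w → v ≡ w
  toList-injective {v = v} {w} e = trans (sym (Vec.cast-is-id refl v)) (Vec.toList-injective refl v w e)

  ∈-words : ∀ {xs : List A} l → All (_∈ xs) l → fromList l ∈ words xs (length l)
  ∈-words []      []         = here refl
  ∈-words (a ∷ l) (a∈ ∷ l∈) = ∈-cartesianProductWith⁺ _∷_ a∈ (∈-words l l∈)

  ∈-lists : ∀ {xs : List A} l → All (_∈ xs) l → l ∈ map toList (words xs (length l))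
  ∈-lists {xs = xs} l l∈ = subst (_∈ map toList (words xs (length l))) (Vec.toList∘fromList l) (∈-map⁺ toList (∈-words l l∈))

  fillings-unique : ∀ ν n → Unique (fillings ν n)
  fillings-unique []      n = [] ∷ []
  fillings-unique (k ∷ ν) n = Unique.cartesianProductWith⁺ (λ r T → toList r ∷ T)
    (λ e → toList-injective (∷-injectiveˡ e) , ∷-injectiveʳ e)
    (words-unique (Unique.allFin⁺ n) k) (fillings-unique ν n)

  fillings-shape : ∀ ν {n T} → T ∈ fillings ν n → map length T ≡ ν
  fillings-shape []      (here refl) = refl
  fillings-shape (k ∷ ν) T∈ with ∈-cartesianProductWith⁻ _ (words (allFin _) k) (fillings ν _) T∈
  ... | r , T , _ , T∈′ , refl = cong₂ _∷_ (Vec.length-toList r) (fillings-shape ν T∈′)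

  ∈-fillings : ∀ {n} (T : List (List (Fin n))) → T ∈ fillings (map length T) n
  ∈-fillings []      = here refl
  ∈-fillings {n} (r ∷ T) = subst (λ r′ → r′ ∷ T ∈ fillings (length r ∷ map length T) n) (Vec.toList∘fromList r)
    (∈-cartesianProductWith⁺ (λ r T → toList r ∷ T) (∈-words r (All.tabulate (λ _ → ∈-allFin _))) (∈-fillings T))

  private
    candidates : ℕ → ℕ → List (List ℕ)
    candidates n k = map toList (words (upTo (suc n)) k)

    isPartitionOf? : ∀ n → U.Decidable (λ μ → IsPartition μ × sum μ ≡ n)
    isPartitionOf? n μ = isPartition? μ ×-dec (sum μ ≟ n)

  -- Candidates with different numbers of parts have different lengths, so none is listed twice.
  -- This allows one shape to be isolated in a Schur expansion.
  partitions-unique : ∀ n → Unique (partitions n)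
  partitions-unique n = Unique.filter⁺ (isPartitionOf? n) {xs = concatMap (candidates n) (upTo (suc n))}
    (Unique.concat⁺ {xss = map (candidates n) (upTo (suc n))}
      (All.map⁺ {xs = upTo (suc n)} (All.tabulate (λ {k} _ → Unique.map⁺ toList-injective (words-unique (Unique.upTo⁺ (suc n)) k))))
      (AllPairs.map⁺ {f = candidates n} {xs = upTo (suc n)} (AllPairs.map disjoint (Unique.upTo⁺ (suc n)))))
    where
    length-of : ∀ {k l} → l ∈ candidates n k → length l ≡ k
    length-of l∈ with ∈-map⁻ toList l∈
    ... | v , _ , refl = Vec.length-toList v
    disjoint : ∀ {j k} → j ≢ k → ∀ {l} → ¬ (l ∈ candidates n j × l ∈ candidates n k)
    disjoint j≢k (l∈j , l∈k) = j≢k (trans (sym (length-of l∈j)) (length-of l∈k))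

  ∈-partitions⁻ : ∀ {n ν} → ν ∈ partitions n → IsPartition ν × sum ν ≡ n
  ∈-partitions⁻ {n} ν∈ = proj₂ (∈-filter⁻ (isPartitionOf? n) {xs = concatMap (candidates n) (upTo (suc n))} ν∈)

  ∈-partitions⁺ : ∀ {ν} → IsPartition ν → ν ∈ partitions (sum ν)
  ∈-partitions⁺ {ν} ν-part = ∈-filter⁺ (isPartitionOf? (sum ν)) {xs = concatMap (candidates (sum ν)) (upTo (suc (sum ν)))}
    (∈-concatMap⁺ (candidates (sum ν)) {xs = upTo (suc (sum ν))}
      (Any.map (λ { refl → ∈-lists ν (All.map (∈-upTo⁺ ∘ s≤s) (parts≤sum ν)) }) (∈-upTo⁺ (s≤s (length≤sum (proj₂ ν-part))))))
    (ν-part , refl)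
    where
    length≤sum : ∀ {ν} → All (1 ≤_) ν → length ν ≤ sum ν
    length≤sum []       = z≤n
    length≤sum (h ∷ hs) = +-mono-≤ h (length≤sum hs)
    parts≤sum : ∀ ν → All (_≤ sum ν) ν
    parts≤sum []      = []
    parts≤sum (k ∷ ν) = m≤m+n k (sum ν) ∷ All.map (λ h → ≤-trans h (m≤n+m (sum ν) k)) (parts≤sum ν)

  -- The general form of a weakly increasing row, by `sorted⇒row`; 0F and 1F stand for the entries 1
  -- and 2.
  row : ℕ → ℕ → List (Fin 2)
  row a b = replicate a 0F ++ replicate b 1F

  row-sorted : ∀ a b → Linked Fin._≤_ (row a b)
  row-sorted zero          zero          = []
  row-sorted zero          (suc zero)    = [-]
  row-sorted zero          (suc (suc b)) = s≤s z≤n ∷ row-sorted zero (suc b)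
  row-sorted (suc zero)    zero          = [-]
  row-sorted (suc zero)    (suc b)       = z≤n ∷ row-sorted zero (suc b)
  row-sorted (suc (suc a)) b             = z≤n ∷ row-sorted (suc a) b

  sorted⇒row : ∀ {r} → Linked Fin._≤_ r → ∃₂ λ a b → r ≡ row a b
  sorted⇒row {[]}    _ = 0 , 0 , refl
  sorted⇒row {i ∷ r} l with sorted⇒row (Linked.tail l)
  sorted⇒row {0F ∷ _} _        | a     , b , refl = suc a , b , refl
  sorted⇒row {1F ∷ _} _        | zero  , b , refl = zero , suc b , refl
  sorted⇒row {1F ∷ _} (() ∷ _) | suc a , b , refl

  above-row⁺ : ∀ {a b m} → m ≤ a → Above (row a b) (row 0 m)
  above-row⁺ {zero}  {zero}  {zero}  _ = []
  above-row⁺ {zero}  {suc b} {zero}  _ = []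
  above-row⁺ {suc a} {b}     {zero}  _ = []
  above-row⁺ {suc a} {b}     {suc m} (s≤s m≤a) = s≤s z≤n ∷ above-row⁺ m≤a

  -- Only 1F fits below 0F, and nothing fits below 1F. As `zip` drops unmatched cells, the bound on
  -- the length of s ensures that each of its cells is tested.
  above-row⁻ : ∀ a b s → length s ≤ a + b → Above (row a b) s → s ≡ row 0 (length s) × length s ≤ a
  above-row⁻ a       b       []       _ _ = refl , z≤n
  above-row⁻ zero    (suc b) (0F ∷ s) _ (() ∷ _)
  above-row⁻ zero    (suc b) (1F ∷ s) _ (s≤s () ∷ _)
  above-row⁻ (suc a) b       (0F ∷ s) _ (() ∷ _)
  above-row⁻ (suc a) b       (1F ∷ s) (s≤s h) (_ ∷ t) with above-row⁻ a b s h t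
  ... | e , l = cong (1F ∷_) e , s≤s l

  length-row : ∀ a b → length (row a b) ≡ a + b
  length-row a b = trans (length-++ (replicate a 0F)) (cong₂ _+_ (length-replicate a) (length-replicate b))

  occurrences : Fin 2 → List (Fin 2) → ℕ
  occurrences i r = length (filter (i Fin.≟_) r)

  occurrences-++ : ∀ i r s → occurrences i (r ++ s) ≡ occurrences i r + occurrences i s
  occurrences-++ i r s = trans (cong length (filter-++ (i Fin.≟_) r s)) (length-++ (filter (i Fin.≟_) r))

  occurrences-row₀ : ∀ a b → occurrences 0F (row a b) ≡ a
  occurrences-row₀ zero    zero    = refl
  occurrences-row₀ zero    (suc b) = occurrences-row₀ zero b
  occurrences-row₀ (suc a) b       = cong suc (occurrences-row₀ a b)

  occurrences-row₁ : ∀ a b → occurrences 1F (row a b) ≡ b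
  occurrences-row₁ zero    zero    = refl
  occurrences-row₁ zero    (suc b) = cong suc (occurrences-row₁ zero b)
  occurrences-row₁ (suc a) b       = occurrences-row₁ a b

  Tableau : ∀ {n} → Vec ℕ n → List (List (Fin n)) → Set
  Tableau e T = Semistandard T × HasContent e T

  kostka : List ℕ → ℕ → ℕ → ℕ
  kostka ν p q = length (filter (λ T → semistandard? T ×-dec hasContent? (p ∷ q ∷ []) T) (fillings ν 2))

  kostka-1 : ∀ {p q} T → Tableau (p ∷ q ∷ []) T →
    (∀ {T′} → map length T′ ≡ map length T → Tableau (p ∷ q ∷ []) T′ → T′ ≡ T) → kostka (map length T) p q ≡ 1
  kostka-1 {p} {q} T T-tab only = begin
    kostka (map length T) p q
      ≡⟨ length-filter-as-∑ tableau? Ts ⟩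
    ∑ Ts (λ T′ → 𝟙 (does (tableau? T′)))
      ≡⟨ ∑-single (fillings-unique (map length T) 2) (∈-fillings T)
           (λ {T′} T′∈ T′≢T → cong 𝟙 (dec-false (tableau? T′) (T′≢T ∘ only (fillings-shape (map length T) T′∈)))) ⟩
    𝟙 (does (tableau? T))
      ≡⟨ cong 𝟙 (dec-true (tableau? T) T-tab) ⟩
    1 ∎
    where
    open ≡-Reasoning
    Ts = fillings (map length T) 2
    tableau? = λ T → semistandard? T ×-dec hasContent? (p ∷ q ∷ []) T

  kostka-0 : ∀ {ν p q} → (∀ {T} → map length T ≡ ν → ¬ Tableau (p ∷ q ∷ []) T) → kostka ν p q ≡ 0
  kostka-0 {ν} {p} {q} none = cong length
    (filter-none (λ T → semistandard? T ×-dec hasContent? (p ∷ q ∷ []) T) (All.tabulate (λ T∈ → none (fillings-shape ν T∈))))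

  content-one : ∀ {p q} a b → HasContent (p ∷ q ∷ []) (row a b ∷ []) → p ≡ a × q ≡ b
  content-one a b c =
      trans (sym (c 0F)) (trans (cong (occurrences 0F) (++-identityʳ (row a b))) (occurrences-row₀ a b))
    , trans (sym (c 1F)) (trans (cong (occurrences 1F) (++-identityʳ (row a b))) (occurrences-row₁ a b))

  occurrences-two : ∀ i a b m → occurrences i (concat (row a b ∷ row 0 m ∷ [])) ≡ occurrences i (row a b) + occurrences i (row 0 m)
  occurrences-two i a b m = trans (occurrences-++ i (row a b) (row 0 m ++ []))
    (cong (λ s → occurrences i (row a b) + occurrences i s) (++-identityʳ (row 0 m)))

  two-rows₀ : ∀ a b m → occurrences 0F (concat (row a b ∷ row 0 m ∷ [])) ≡ a
  two-rows₀ a b m = trans (occurrences-two 0F a b m)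
    (trans (cong₂ _+_ (occurrences-row₀ a b) (occurrences-row₀ 0 m)) (+-identityʳ a))

  two-rows₁ : ∀ a b m → occurrences 1F (concat (row a b ∷ row 0 m ∷ [])) ≡ b + m
  two-rows₁ a b m = trans (occurrences-two 1F a b m) (cong₂ _+_ (occurrences-row₁ a b) (occurrences-row₁ 0 m))

  two-rows : ∀ {r s T} → length s ≤ length r → Semistandard (r ∷ s ∷ T) →
    ∃₂ λ a b → r ≡ row a b × s ≡ row 0 (length s) × length s ≤ a
  two-rows {s = s} s≤r (r-sorted ∷ _ , r-s ∷ _) with sorted⇒row r-sorted
  ... | a , b , refl = a , b , refl , above-row⁻ a b s (subst (length s ≤_) (length-row a b) s≤r) r-s

  kostka-one-row : ∀ p q → kostka (p + q ∷ []) p q ≡ 1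
  kostka-one-row p q = trans (cong (λ k → kostka (k ∷ []) p q) (sym (length-row p q)))
    (kostka-1 (row p q ∷ []) ((row-sorted p q ∷ [] , [-]) , content) only)
    where
    content : HasContent (p ∷ q ∷ []) (row p q ∷ [])
    content 0F = trans (cong (occurrences 0F) (++-identityʳ (row p q))) (occurrences-row₀ p q)
    content 1F = trans (cong (occurrences 1F) (++-identityʳ (row p q))) (occurrences-row₁ p q)
    only : ∀ {T} → map length T ≡ map length (row p q ∷ []) → Tableau (p ∷ q ∷ []) T → T ≡ row p q ∷ []
    only {r ∷ []} _ ((r-sorted ∷ [] , _) , c) with sorted⇒row r-sorted
    ... | a , b , refl with content-one a b c
    ... | refl , refl = refl

  -- Parametrised by the only tableau: p ones and b twos in the first row, m twos below. The bound m
  -- ≤ p puts each of these under a one.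
  kostka-two-rows-1 : ∀ p b m → m ≤ p → kostka (p + b ∷ m ∷ []) p (b + m) ≡ 1
  kostka-two-rows-1 p b m m≤p = trans
    (cong₂ (λ k l → kostka (k ∷ l ∷ []) p (b + m)) (sym (length-row p b)) (sym (length-row 0 m)))
    (kostka-1 (row p b ∷ row 0 m ∷ [])
      ((row-sorted p b ∷ row-sorted 0 m ∷ [] , above-row⁺ m≤p ∷ [-]) , content) only)
    where
    content : HasContent (p ∷ b + m ∷ []) (row p b ∷ row 0 m ∷ [])
    content 0F = two-rows₀ p b m
    content 1F = two-rows₁ p b m
    only : ∀ {T} → map length T ≡ map length (row p b ∷ row 0 m ∷ []) → Tableau (p ∷ b + m ∷ []) T → T ≡ row p b ∷ row 0 m ∷ []
    only {r ∷ s ∷ []} shape (ss , c) with two-rows s≤r ss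
      where
      r≡ : length r ≡ p + b
      r≡ = trans (∷-injectiveˡ shape) (length-row p b)
      s≡ : length s ≡ m
      s≡ = trans (∷-injectiveˡ (∷-injectiveʳ shape)) (length-row 0 m)
      s≤r : length s ≤ length r
      s≤r = subst₂ _≤_ (sym s≡) (sym r≡) (≤-trans m≤p (m≤m+n p b))
    ... | a , b′ , refl , s≡row , _ = cong₂ (λ u v → u ∷ v ∷ []) (cong₂ row a≡p b′≡b) s≡
      where
      s≡ : s ≡ row 0 m
      s≡ = trans s≡row (cong (row 0) (trans (∷-injectiveˡ (∷-injectiveʳ shape)) (length-row 0 m)))
      a≡p : a ≡ p
      a≡p = trans (sym (two-rows₀ a b′ m)) (trans (cong (λ s → occurrences 0F (row a b′ ++ (s ++ []))) (sym s≡)) (c 0F))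
      b′≡b : b′ ≡ b
      b′≡b = +-cancelˡ-≡ p b′ b (trans (cong (_+ b′) (sym a≡p)) (trans (sym (length-row a b′)) (trans (∷-injectiveˡ shape) (length-row p b))))

  -- The second row would need m twos, and the content offers only q.
  kostka-two-rows-0 : ∀ {k m p q} → m ≤ k → q < m → kostka (k ∷ m ∷ []) p q ≡ 0
  kostka-two-rows-0 {k} {m} {p} {q} m≤k q<m = kostka-0 none
    where
    none : ∀ {T} → map length T ≡ k ∷ m ∷ [] → ¬ Tableau (p ∷ q ∷ []) T
    none {r ∷ s ∷ []} refl (ss , c) with two-rows m≤k ss
    ... | a , b , refl , s≡ , _ = <⇒≱ q<m (subst (m ≤_) q≡ (m≤n+m m b))
      where
      q≡ : b + length s ≡ q
      q≡ = trans (sym (two-rows₁ a b (length s))) (trans (cong (λ s → occurrences 1F (row a b ++ (s ++ []))) (sym s≡)) (c 1F))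

  -- The second row consists of twos, below which nothing fits, while the third row has at least one
  -- cell.
  kostka-three-rows : ∀ {k l m ν p q} → IsPartition (k ∷ l ∷ m ∷ ν) → kostka (k ∷ l ∷ m ∷ ν) p q ≡ 0
  kostka-three-rows {k} {l} {m} {ν} {p} {q} (l≤k ∷ m≤l ∷ _ , _ ∷ _ ∷ 1≤m ∷ _) = kostka-0 none
    where
    none : ∀ {T} → map length T ≡ k ∷ l ∷ m ∷ ν → ¬ Tableau (p ∷ q ∷ []) T
    none {r ∷ s ∷ t ∷ _} refl (ss@(_ , _ ∷ s-t ∷ _) , _) with two-rows l≤k ss
    ... | _ , _ , refl , s≡ , _ = <⇒≱ 1≤m
      (proj₂ (above-row⁻ 0 (length s) t m≤l (subst (λ s → Above s t) s≡ s-t)))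

-- Schur coefficients of Y and strong log-concavity.

module Conclusion where
  open SpiderPositivity
  open SpiderIndependence
  open Multicolorings
  open TwoVariableTableaux
  open import Data.Integer using (ℤ; 0ℤ)
  import Data.Integer as ℤ
  import Data.Integer.Properties as ℤ
  open import Data.List using (List; []; _∷_; length; map; foldr)
  open import Data.List.Membership.Propositional using (_∈_)
  open import Data.List.Relation.Unary.All as All using (All; []; _∷_)
  open import Data.List.Relation.Unary.AllPairs using ([]; _∷_)
  open import Data.List.Relation.Unary.Any using (here; there)
  open import Data.List.Relation.Unary.Linked using ([]; _∷_)
  open import Data.List.Relation.Unary.Unique.Propositional using (Unique)
  open import Data.Nat using (ℕ; zero; suc; _+_; _*_; _∸_; _≤_; _<_; _≤?_; z≤n; s≤s; s≤s⁻¹)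
  open import Data.Nat.ListAction using (sum)
  open import Data.Nat.Properties hiding (_≤?_)
  open import Data.Product using (_×_; _,_)
  open import Data.Sum using (_⊎_; inj₁; inj₂)
  open import Data.Vec using ([]; _∷_)
  open import Function using (_∘_)
  open import Relation.Binary.Definitions using (tri<; tri≈; tri>)
  open import Relation.Binary.PropositionalEquality
  open import Relation.Nullary using (yes; no; contradiction)

  second : List ℕ → ℕ
  second (_ ∷ m ∷ _) = m
  second _           = 0

  -- The second row, being all twos, determines the tableau. Together with `kostka-value-0`, the
  -- Kostka number at (p, q) with q ≤ p is 1 or 0 according to whether the shape has at most two
  -- rows, the second of length at most q.
  kostka-value-1 : ∀ ν {p q} → sum ν ≡ p + q → q ≤ p → length ν ≤ 2 → second ν ≤ q → kostka ν p q ≡ 1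
  kostka-value-1 [] {zero} {zero} _ _ _ _ = refl
  kostka-value-1 (k ∷ []) {p} {q} k≡ _ _ _ =
    trans (cong (λ k → kostka (k ∷ []) p q) (trans (sym (+-identityʳ k)) k≡)) (kostka-one-row p q)
  kostka-value-1 (k ∷ m ∷ []) {p} {q} k+m≡ q≤p _ m≤q = trans
    (cong₂ (λ k q → kostka (k ∷ m ∷ []) p q) k≡ q≡)
    (kostka-two-rows-1 p (q ∸ m) m (≤-trans m≤q q≤p))
    where
    q≡ : q ≡ q ∸ m + m
    q≡ = sym (m∸n+n≡m m≤q)
    k≡ : k ≡ p + (q ∸ m)
    k≡ = +-cancelʳ-≡ m k (p + (q ∸ m)) (trans (cong (k +_) (sym (+-identityʳ m)))
      (trans k+m≡ (trans (cong (p +_) q≡) (sym (+-assoc p (q ∸ m) m)))))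
  kostka-value-1 (_ ∷ _ ∷ _ ∷ _) _ _ (s≤s (s≤s ())) _

  kostka-value-0 : ∀ {ν p q} → IsPartition ν → 2 < length ν ⊎ q < second ν → kostka ν p q ≡ 0
  kostka-value-0 {_ ∷ _ ∷ _ ∷ _} ν-part _ = kostka-three-rows ν-part
  kostka-value-0 {k ∷ m ∷ []} (m≤k ∷ _ , _) (inj₂ q<m) = kostka-two-rows-0 m≤k q<m
  kostka-value-0 {_ ∷ _ ∷ []} _ (inj₁ (s≤s (s≤s ())))
  kostka-value-0 {_ ∷ []}     _ (inj₁ (s≤s ()))
  kostka-value-0 {[]}         _ (inj₁ ())

  -- Lowering the number of twos from b + 1 to b matters only if the second row has length exactly b
  -- + 1, and then the size determines the shape.
  kostka-shift : ∀ {ν a b} → IsPartition ν → sum ν ≡ a + suc b → b < a → ν ≢ a ∷ suc b ∷ [] →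
    kostka ν a (suc b) ≡ kostka ν (suc a) b
  kostka-shift {ν} {a} {b} ν-part s b<a ν≢ with length ν ≤? 2 | <-cmp (second ν) (suc b)
  ... | no l | _ = trans (kostka-value-0 ν-part (inj₁ (≰⇒> l))) (sym (kostka-value-0 ν-part (inj₁ (≰⇒> l))))
  ... | yes l | tri< m<b _ _ = trans
    (kostka-value-1 ν s b<a l (<⇒≤ m<b))
    (sym (kostka-value-1 ν (trans s (+-suc a b)) (≤-trans (<⇒≤ b<a) (n≤1+n a)) l (s≤s⁻¹ m<b)))
  ... | yes l | tri> _ _ m>b = trans (kostka-value-0 ν-part (inj₂ m>b)) (sym (kostka-value-0 ν-part (inj₂ (<⇒≤ m>b))))
  kostka-shift {_ ∷ _ ∷ _ ∷ _} _ _ _ _ | yes (s≤s (s≤s ())) | tri≈ _ _ _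
  kostka-shift {k ∷ m ∷ []} {a} {b} _ s _ ν≢ | yes _ | tri≈ _ refl _ = contradiction
    (cong (λ k → k ∷ suc b ∷ []) (+-cancelʳ-≡ (suc b) k a (trans (cong (k +_) (sym (+-identityʳ (suc b)))) s))) ν≢

  -- Without twos there is no second row, and a shape with at most one row is determined by its
  -- size; for a = 0 it is empty.
  kostka-content-one : ∀ {ν a μ} → IsPartition ν → IsPartition μ → sum ν ≡ a → sum μ ≡ a → length μ ≤ 1 → ν ≢ μ → kostka ν a 0 ≡ 0
  kostka-content-one {_ ∷ m ∷ _} ν-part@(_ , _ ∷ 1≤m ∷ _) _ _ _ _ _ = kostka-value-0 ν-part (inj₂ 1≤m)
  kostka-content-one {[]}     {μ = []}     _ _ _ _ _ ν≢ = contradiction refl ν≢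
  kostka-content-one {k ∷ []} {μ = l ∷ []} _ _ refl e _ ν≢ =
    contradiction (cong (_∷ []) (trans (sym (+-identityʳ k)) (trans (sym e) (+-identityʳ l)))) ν≢
  kostka-content-one {[]}     {μ = l ∷ []} _ (_ , 1≤l ∷ _) refl e _ _ = contradiction (trans (sym e) (+-identityʳ l)) (<⇒≢ 1≤l)
  kostka-content-one {k ∷ []} {μ = []}     (_ , 1≤k ∷ _) _ refl e _ _ = contradiction (trans e (+-identityʳ k)) (<⇒≢ 1≤k)
  kostka-content-one {μ = _ ∷ _ ∷ _} _ _ _ _ (s≤s ()) _

  module _ (c : List ℕ → ℤ) where

    weighted : (List ℕ → ℕ) → List (List ℕ) → ℤ
    weighted K νs = foldr ℤ._+_ 0ℤ (map (λ ν → c ν ℤ.* ℤ.+ K ν) νs)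

    weighted-cong : ∀ {K K′} νs → (∀ {ν} → ν ∈ νs → K ν ≡ K′ ν) → weighted K νs ≡ weighted K′ νs
    weighted-cong []       h = refl
    weighted-cong (ν ∷ νs) h = cong₂ (λ k s → c ν ℤ.* ℤ.+ k ℤ.+ s) (h (here refl)) (weighted-cong νs (h ∘ there))

    weighted-0 : ∀ νs → weighted (λ _ → 0) νs ≡ 0ℤ
    weighted-0 []       = refl
    weighted-0 (ν ∷ νs) = trans (cong₂ ℤ._+_ (ℤ.*-zeroʳ (c ν)) (weighted-0 νs)) (ℤ.+-identityʳ 0ℤ)

    -- Isolates one coefficient by comparing two sums whose weights differ, by one, at a single
    -- shape. It serves for two neighbouring contents and for comparison with the weight 0.
    weighted-differ : ∀ {K K′ μ νs} → Unique νs → μ ∈ νs → (∀ {ν} → ν ∈ νs → ν ≢ μ → K ν ≡ K′ ν) → K μ ≡ suc (K′ μ) →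
      weighted K νs ≡ c μ ℤ.+ weighted K′ νs
    weighted-differ {K} {K′} {μ} {_ ∷ νs} (μ∉ ∷ _) (here refl) h e = begin
      c μ ℤ.* ℤ.+ K μ ℤ.+ weighted K νs
        ≡⟨ cong₂ (λ k s → c μ ℤ.* ℤ.+ k ℤ.+ s) e (weighted-cong νs (λ ν∈ → h (there ν∈) (All.lookup μ∉ ν∈ ∘ sym))) ⟩
      c μ ℤ.* ℤ.suc (ℤ.+ K′ μ) ℤ.+ weighted K′ νs
        ≡⟨ cong (ℤ._+ weighted K′ νs) (ℤ.*-suc (c μ) (ℤ.+ K′ μ)) ⟩
      c μ ℤ.+ c μ ℤ.* ℤ.+ K′ μ ℤ.+ weighted K′ νs
        ≡⟨ ℤ.+-assoc (c μ) _ _ ⟩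
      c μ ℤ.+ weighted K′ (μ ∷ νs) ∎
      where open ≡-Reasoning
    weighted-differ {K} {K′} {μ} {ν ∷ νs} (ν∉ ∷ u) (there μ∈) h e = begin
      c ν ℤ.* ℤ.+ K ν ℤ.+ weighted K νs
        ≡⟨ cong₂ (λ k s → c ν ℤ.* ℤ.+ k ℤ.+ s) (h (here refl) (All.lookup ν∉ μ∈)) (weighted-differ u μ∈ (h ∘ there) e) ⟩
      c ν ℤ.* ℤ.+ K′ ν ℤ.+ (c μ ℤ.+ weighted K′ νs)
        ≡⟨ ℤ.+-assoc (c ν ℤ.* ℤ.+ K′ ν) (c μ) _ ⟨
      c ν ℤ.* ℤ.+ K′ ν ℤ.+ c μ ℤ.+ weighted K′ νs
        ≡⟨ cong (ℤ._+ weighted K′ νs) (ℤ.+-comm (c ν ℤ.* ℤ.+ K′ ν) (c μ)) ⟩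
      c μ ℤ.+ c ν ℤ.* ℤ.+ K′ ν ℤ.+ weighted K′ νs
        ≡⟨ ℤ.+-assoc (c μ) _ _ ⟩
      c μ ℤ.+ weighted K′ (ν ∷ νs) ∎
      where open ≡-Reasoning

    module _ {f : Series} (expansion : IsSchurExpansion f c) where

      expansion₂ : ∀ {n} p q → p + q ≡ n → f (p ∷ q ∷ []) ≡ weighted (λ ν → kostka ν p q) (partitions n)
      expansion₂ p q refl = trans (expansion (p ∷ q ∷ [])) (cong (λ q′ → weighted (λ ν → kostka ν p q) (partitions (p + q′))) (+-identityʳ q))

      coefficient-two-rows : ∀ {a b} → IsPartition (a ∷ suc b ∷ []) → f (a ∷ suc b ∷ []) ≡ c (a ∷ suc b ∷ []) ℤ.+ f (suc a ∷ b ∷ [])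
      coefficient-two-rows {a} {b} μ-part@(b<a ∷ _ , _) = begin
        f (a ∷ suc b ∷ [])
          ≡⟨ expansion₂ a (suc b) refl ⟩
        weighted (λ ν → kostka ν a (suc b)) (partitions (a + suc b))
          ≡⟨ weighted-differ (partitions-unique (a + suc b)) μ∈
               (λ ν∈ → let ν-part , s = ∈-partitions⁻ ν∈ in kostka-shift ν-part s b<a)
               (trans (kostka-value-1 (a ∷ suc b ∷ []) size b<a ≤-refl ≤-refl) (cong suc (sym (kostka-value-0 μ-part (inj₂ ≤-refl))))) ⟩
        c (a ∷ suc b ∷ []) ℤ.+ weighted (λ ν → kostka ν (suc a) b) (partitions (a + suc b))
          ≡⟨ cong (λ s → c (a ∷ suc b ∷ []) ℤ.+ s) (expansion₂ (suc a) b (sym (+-suc a b))) ⟨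
        c (a ∷ suc b ∷ []) ℤ.+ f (suc a ∷ b ∷ []) ∎
        where
        open ≡-Reasoning
        size : sum (a ∷ suc b ∷ []) ≡ a + suc b
        size = cong (a +_) (+-identityʳ (suc b))
        μ∈ : a ∷ suc b ∷ [] ∈ partitions (a + suc b)
        μ∈ = subst (λ n → a ∷ suc b ∷ [] ∈ partitions n) size (∈-partitions⁺ μ-part)

      -- At the content (a, 0) every other shape of size a has Kostka number 0. The exponent 0 of
      -- the second variable keeps the computation within two-letter contents.
      coefficient-one-row : ∀ {μ} → IsPartition μ → length μ ≤ 1 → c μ ≡ f (sum μ ∷ 0 ∷ [])
      coefficient-one-row {μ} μ-part l = sym (begin
        f (a ∷ 0 ∷ [])
          ≡⟨ expansion₂ a 0 (+-identityʳ a) ⟩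
        weighted (λ ν → kostka ν a 0) (partitions a)
          ≡⟨ weighted-differ (partitions-unique a) (∈-partitions⁺ μ-part)
               (λ ν∈ ν≢ → let ν-part , s = ∈-partitions⁻ ν∈ in kostka-content-one ν-part μ-part s refl l ν≢)
               (kostka-value-1 μ (sym (+-identityʳ a)) z≤n (m≤n⇒m≤1+n l) (≤-reflexive (second-0 μ l))) ⟩
        c μ ℤ.+ weighted (λ _ → 0) (partitions a)
          ≡⟨ cong (λ s → c μ ℤ.+ s) (weighted-0 (partitions a)) ⟩
        c μ ℤ.+ 0ℤ
          ≡⟨ ℤ.+-identityʳ (c μ) ⟩
        c μ ∎)
        where
        open ≡-Reasoning
        a = sum μ
        second-0 : ∀ μ → length μ ≤ 1 → second μ ≡ 0
        second-0 []      _ = refl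
        second-0 (_ ∷ []) _ = refl
        second-0 (_ ∷ _ ∷ _) (s≤s ())

  -- Moves two indices apart by one. For independence numbers and n < m, the right side minus the
  -- left is the coefficient of s_(m,n+1) in Y; for n = m the sides agree.
  Steps : (ℕ → ℕ) → Set
  Steps a = ∀ {m n} → n ≤ m → a (suc m) * a n ≤ a m * a (suc n)

  -- The pair (m, n) moves outwards to (p, q) in m - p unit steps, during which the smaller index
  -- stays below the larger, as `Steps` demands.
  steps⇒stronglyLogConcave : ∀ a d → Steps a → StronglyLogConcave a d
  steps⇒stronglyLogConcave a d step p m n q p<m m≤n n<q _ m+n≡p+q = begin
    a p * a q              ≡⟨ *-comm (a p) (a q) ⟩
    a q * a p              ≡⟨ cong (λ k → a k * a p) q≡ ⟩
    a (r + n) * a p        ≤⟨ spread r p n (≤-trans (≤-reflexive r+p≡m) m≤n) ⟩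
    a n * a (r + p)        ≡⟨ cong (λ k → a n * a k) r+p≡m ⟩
    a n * a m              ≡⟨ *-comm (a n) (a m) ⟩
    a m * a n              ∎
    where
    open ≤-Reasoning
    r = m ∸ p
    r+p≡m : r + p ≡ m
    r+p≡m = m∸n+n≡m (<⇒≤ p<m)
    q≡ : q ≡ r + n
    q≡ = +-cancelˡ-≡ p q (r + n) (trans (sym m+n≡p+q) (trans (cong (_+ n) (trans (sym r+p≡m) (+-comm r p))) (+-assoc p r n)))
    spread : ∀ r p n → r + p ≤ n → a (r + n) * a p ≤ a n * a (r + p)
    spread zero    p n _ = ≤-refl
    spread (suc r) p n h = ≤-trans (step (≤-trans (m≤n+m p (suc r)) (≤-trans h (m≤n+m n r))))
      (≤-trans (spread r (suc p) n (≤-trans (≤-reflexive (+-suc r p)) h)) (≤-reflexive (cong (λ k → a n * a k) (+-suc r p))))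

  Y-twoSPositive : ∀ G → Steps (indepCoeff G) → TwoSPositive (Y G)
  Y-twoSPositive G step = record { isSymmetric = Y-isSymmetric G ; nonNegative = nonNegative }
    where
    a = indepCoeff G
    one-row : ∀ c → IsSchurExpansion (Y G) c → ∀ μ → IsPartition μ → length μ ≤ 1 → 0ℤ ℤ.≤ c μ
    one-row c expansion μ μ-part l =
      subst (0ℤ ℤ.≤_) (sym (trans (coefficient-one-row c expansion μ-part l) (Y-product G (sum μ ∷ 0 ∷ [])))) (ℤ.+≤+ z≤n)
    nonNegative : ∀ c → IsSchurExpansion (Y G) c → ∀ μ → IsPartition μ → length μ ≤ 2 → 0ℤ ℤ.≤ c μ
    nonNegative c expansion []       μ-part _ = one-row c expansion [] μ-part z≤n
    nonNegative c expansion (k ∷ []) μ-part _ = one-row c expansion (k ∷ []) μ-part ≤-refl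
    -- The inequality of `Steps` says that z is at most the coefficient of Y at (k, m + 1), which is
    -- c μ + z; subtracting z leaves 0 ≤ c μ.
    nonNegative c expansion (k ∷ suc m ∷ []) μ-part@(m<k ∷ _ , _) _ = subst (0ℤ ℤ.≤_) difference (ℤ.i≤j⇒0≤j-i (begin
      z                               ≤⟨ ℤ.+≤+ (subst₂ (λ u v → a (suc k) * u ≤ a k * v) (sym (*-identityʳ _)) (sym (*-identityʳ _)) (step (<⇒≤ m<k))) ⟩
      ℤ.+ (a k * (a (suc m) * 1))     ≡⟨ Y-product G (k ∷ suc m ∷ []) ⟨
      Y G (k ∷ suc m ∷ [])            ≡⟨ coefficient-two-rows c expansion μ-part ⟩
      c μ ℤ.+ Y G (suc k ∷ m ∷ [])    ≡⟨ cong (λ s → c μ ℤ.+ s) (Y-product G (suc k ∷ m ∷ [])) ⟩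
      c μ ℤ.+ z                       ∎))
      where
      open ℤ.≤-Reasoning
      μ = k ∷ suc m ∷ []
      z = ℤ.+ (a (suc k) * (a m * 1))
      difference : c μ ℤ.+ z ℤ.- z ≡ c μ
      difference = trans (ℤ.+-assoc (c μ) z (ℤ.- z)) (trans (cong (λ s → c μ ℤ.+ s) (ℤ.+-inverseʳ z)) (ℤ.+-identityʳ (c μ)))
    nonNegative c expansion (_ ∷ 0 ∷ []) (_ , _ ∷ () ∷ _) _
    nonNegative c expansion (_ ∷ _ ∷ _ ∷ _) _ (s≤s (s≤s ()))

  spider-steps : ∀ μ → Steps (indepCoeff (spider μ))
  spider-steps μ {m} {n} n≤m = subst₂ _≤_
    (sym (cong₂ _*_ (indepCoeff-spider μ (suc m)) (indepCoeff-spider μ n)))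
    (sym (cong₂ _*_ (indepCoeff-spider μ m) (indepCoeff-spider μ (suc n))))
    (spiderCoeff-step μ n≤m)

open Conclusion

theorem3p1 : (μ : List ℕ) → IsPartition μ →
    TwoSPositive (Y (spider μ)) × StronglyLogConcave (indepCoeff (spider μ)) (independenceNumber (spider μ))
theorem3p1 μ _ =
  Y-twoSPositive (spider μ) (spider-steps μ) , steps⇒stronglyLogConcave (indepCoeff (spider μ)) _ (spider-steps μ)
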